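{- Let $k\ge 1$ be an integer and let $G$ be a graph on $n$ vertices with adjacency matrix $A$ having eigenvalues $\lambda_1\ge\lambda_2\ge\cdots\ge\lambda_n$ (listed with multiplicity). Then $$\alpha_k(G)\le \left|\{i\in\{1,\dots,n\}:\lambda_i^k\ge w_k(G)\}\right|\quad\text{and}\quad \alpha_k(G)\le \left|\{i\in\{1,\dots,n\}:\lambda_i^k\le W_k(G)\}\right|.$$
   Context: Graphs are finite, undirected, simple and loopless. The $k$-independence number $\alpha_k(G)$ is the maximum size of a set of vertices of $G$ that are pairwise at distance greater than $k$ (vertices in different connected components are at infinite distance). $w_k(G)=\min_i (A^k)_{ii}$ is the minimum, over all vertices $i$ of $G$, of the number of closed walks of length $k$ starting at $i$, and $W_k(G)=\max_i (A^k)_{ii}$ is the corresponding maximum. -}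

module Defs where

open import Level using (Level; _⊔_; 0ℓ) renaming (suc to lsuc)
open import Algebra.Bundles using (Semiring; CommutativeRing)
import Algebra.Definitions.RawSemiring as RawSemiringDefs
open import Data.Bool using (if_then_else_)
open import Data.Fin as Fin using (Fin; toℕ)
import Data.Fin.Properties as Fin
open import Data.Fin.Subset using (Subset; _∈_; ∣_∣)
open import Data.Fin.Subset.Properties using (_∈?_; anySubset?)
open import Data.List using (filter; upTo)
open import Data.List.Extrema.Nat using (max)
open import Data.Nat as ℕ using (ℕ; suc; NonZero)
import Data.Nat.Properties as ℕ
open import Data.Product using (∃; _×_; _,_)
open import Data.Vec using (tabulate; allFin; foldr₁; count)
open import Data.Vec.Functional using (Vector; tail; removeAt)
open import Relation.Binary using (Rel; Symmetric; IsDecTotalOrder)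
import Relation.Binary as Binary
open import Relation.Binary.PropositionalEquality using (_≡_; _≢_; refl)
open import Relation.Nullary using (¬_; Dec; does)
open import Relation.Nullary.Decidable using (map′; _×-dec_; _→-dec_; ¬?)
open import Relation.Unary using (Pred; Decidable)

private
  variable
    a c ℓ ℓ₁ ℓ₂ : Level
    m n : ℕ

-- The field in which the eigenvalues live.  The standard library has no real
-- numbers; classically ℝ is an instance of this record, and so is the field of
-- real algebraic numbers, which contains all eigenvalues of graphs and whose
-- order is decidable constructively.

record OrderedField c ℓ₁ ℓ₂ : Set (lsuc (c ⊔ ℓ₁ ⊔ ℓ₂)) where
  infix 4 _≤_
  field
    commutativeRing : CommutativeRing c ℓ₁
  open CommutativeRing commutativeRing public
  field
    _≤_             : Rel Carrier ℓ₂
    isDecTotalOrder : IsDecTotalOrder _≈_ _≤_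
    0≉1             : 0# ≉ 1#
    inverse         : ∀ x → x ≉ 0# → ∃ λ y → x * y ≈ 1#
    +-mono-≤        : ∀ {w x y z} → w ≤ x → y ≤ z → w + y ≤ x + z
    *-nonneg        : ∀ {x y} → 0# ≤ x → 0# ≤ y → 0# ≤ x * y
  open IsDecTotalOrder isDecTotalOrder public using (_≟_; _≤?_)

Matrix : Set a → ℕ → ℕ → Set a
Matrix A m n = Vector (Vector A n) m

module SemiringMatrix (S : Semiring c ℓ) where
  open Semiring S
  open RawSemiringDefs rawSemiring using (sum)

  𝟙 : Matrix Carrier n n
  𝟙 i j = if does (i Fin.≟ j) then 1# else 0#

  infixl 7 _⊗_
  _⊗_ : Matrix Carrier m n → Matrix Carrier n n → Matrix Carrier m n
  (M ⊗ N) i j = sum λ l → M i l * N l j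

  infixr 8 _^ᴹ_
  _^ᴹ_ : Matrix Carrier n n → ℕ → Matrix Carrier n n
  M ^ᴹ 0       = 𝟙
  M ^ᴹ suc k = M ⊗ M ^ᴹ k

module CharPoly (R : CommutativeRing c ℓ) where
  open CommutativeRing R
  open RawSemiringDefs (Semiring.rawSemiring semiring) using (sum; _^_)
  open SemiringMatrix semiring using (𝟙)

  -- Laplace expansion along the first row.
  det : Matrix Carrier n n → Carrier
  det {0}       M = 1#
  det {suc n} M =
    sum λ j → (- 1#) ^ toℕ j * (M Fin.zero j * det (λ i → removeAt (tail M i) j))

  charPoly : Matrix Carrier n n → Carrier → Carrier
  charPoly M x = det λ i j → x * 𝟙 i j - M i j

record Graph (n : ℕ) : Set₁ where
  field
    Adj       : Rel (Fin n) 0ℓ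
    adj?      : Binary.Decidable Adj
    symmetric : Symmetric Adj
    loopless  : ∀ {u} → ¬ Adj u u

module _ (S : Semiring c ℓ) where
  open Semiring S

  adjacencyMatrix : Graph n → Matrix Carrier n n
  adjacencyMatrix G i j = if does (Graph.adj? G i j) then 1# else 0#

module _ (G : Graph n) where
  open Graph G

  data Walk : Fin n → Fin n → ℕ → Set where
    []  : ∀ {u} → Walk u u 0
    _∷_ : ∀ {u v w ℓ} → Adj u v → Walk v w ℓ → Walk u w (suc ℓ)

  walk? : ∀ u v ℓ → Dec (Walk u v ℓ)
  walk? u v 0         = map′ (λ { refl → [] }) (λ { [] → refl }) (u Fin.≟ v)
  walk? u v (suc ℓ) =
    map′ (λ (_ , e , p) → e ∷ p) (λ { (e ∷ p) → _ , e , p })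
         (Fin.any? λ w → adj? u w ×-dec walk? w v ℓ)

  -- Vertices in different components have no distance in this sense.
  IsDistance : Fin n → Fin n → ℕ → Set
  IsDistance u v d = Walk u v d × (∀ {ℓ} → ℓ ℕ.< d → ¬ Walk u v ℓ)

  isDistance? : ∀ u v d → Dec (IsDistance u v d)
  isDistance? u v d = walk? u v d ×-dec ℕ.allUpTo? (λ ℓ → ¬? (walk? u v ℓ)) d

  -- The distance from u to v is greater than k, or infinite.
  FartherThan : ℕ → Fin n → Fin n → Set
  FartherThan k u v = ∀ d → IsDistance u v d → k ℕ.< d

  fartherThan? : ∀ k u v → Dec (FartherThan k u v)
  fartherThan? k u v =
    map′ (λ f d D → ℕ.≰⇒> λ d≤k → f {d} (ℕ.s≤s d≤k) D)
         (λ f {d} d<1+k D → ℕ.<⇒≱ (f d D) (ℕ.s≤s⁻¹ d<1+k))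
         (ℕ.allUpTo? (λ d → ¬? (isDistance? u v d)) (suc k))

  Independent : ℕ → Subset n → Set
  Independent k U = ∀ u v → u ∈ U → v ∈ U → u ≢ v → FartherThan k u v

  independent? : ∀ k → Decidable (Independent k)
  independent? k U =
    Fin.all? λ u → Fin.all? λ v →
      (u ∈? U) →-dec (v ∈? U) →-dec ¬? (u Fin.≟ v) →-dec fartherThan? k u v

  independentSetOfSize? : ∀ k s → Dec (∃ λ U → ∣ U ∣ ≡ s × Independent k U)
  independentSetOfSize? k s = anySubset? λ U → (∣ U ∣ ℕ.≟ s) ×-dec independent? k U

-- The default value 0 of max is harmless: the empty set is always independent.
α : ℕ → Graph n → ℕ
α {n} k G = max 0 (filter (independentSetOfSize? G k) (upTo (suc n)))

closedWalks : ℕ → Graph n → Fin n → ℕ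
closedWalks k G i = (adjacencyMatrix ℕ.+-*-semiring G ^ᴹ k) i i
  where open SemiringMatrix ℕ.+-*-semiring

-- A minimum or maximum over the vertices requires the graph to have a vertex.
w : ℕ → Graph n → .{{NonZero n}} → ℕ
w {suc n} k G = foldr₁ ℕ._⊓_ (tabulate (closedWalks k G))

W : ℕ → Graph n → .{{NonZero n}} → ℕ
W {suc n} k G = foldr₁ ℕ._⊔_ (tabulate (closedWalks k G))

#[_] : {P : Pred (Fin n) a} → Decidable P → ℕ
#[ P? ] = count P? (allFin _)

module Spectrum (F : OrderedField c ℓ₁ ℓ₂) where
  open OrderedField F
  open RawSemiringDefs (Semiring.rawSemiring semiring) public using (_^_; product)
  open RawSemiringDefs (Semiring.rawSemiring semiring) using () renaming (_×_ to _·_)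
  open CharPoly commutativeRing

  fromℕ : ℕ → Carrier
  fromℕ m = m · 1#

  -- λ₁ ≥ ⋯ ≥ λₙ are the eigenvalues of M, repeated according to multiplicity:
  -- the characteristic polynomial of M is (x - λ₁) ⋯ (x - λₙ).  An ordered field
  -- is infinite, so agreement at every x is equality of polynomials.
  record IsSpectrum (M : Matrix Carrier n n) (λs : Vector Carrier n) : Set (c ⊔ ℓ₁ ⊔ ℓ₂) where
    field
      descending : ∀ {i j} → i Fin.≤ j → λs j ≤ λs i
      splits     : ∀ x → charPoly M x ≈ product λ i → x - λs i

{-# OPTIONS --safe #-}
module Submission where

open import Defs
open import Algebra.Bundles using (Semiring; CommutativeRing)
import Algebra.Definitions.RawSemiring as RawSemiringDefs
import Algebra.Properties.AbelianGroup as AbelianGroupProperties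
import Algebra.Properties.Monoid.Mult as MonoidMultiplication
import Algebra.Properties.Monoid.Mult.TCOptimised as MonoidMult
import Algebra.Properties.Ring as RingProperties
import Algebra.Properties.Semiring.Mult as SemiringMultiplication
import Algebra.Properties.Semiring.Mult.TCOptimised as SemiringMult
import Algebra.Properties.Semiring.Sum as SemiringSum
import Algebra.Solver.Ring as RingSolver
import Algebra.Solver.Ring.AlmostCommutativeRing as ACR
open import Data.Bool using (true; false; if_then_else_)
open import Data.Fin as Fin using (Fin; zero; suc; punchIn)
import Data.Fin.Properties as Fin
open import Data.Fin.Subset using (Subset; _∈_; _∉_; ∣_∣; inside; outside; ∁)
open import Data.Fin.Subset.Properties using (_∈?_; ∣p∣≤n; ∣∁p∣≡n∸∣p∣; x∉p⇒x∈∁p)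
open import Data.Integer as ℤ using (ℤ)
import Data.Integer.Properties as ℤ
open import Data.List using (upTo)
open import Data.List.Extrema.Nat using (max≤v⁺)
open import Data.List.Relation.Unary.All as All using (All)
open import Data.List.Relation.Unary.All.Properties using (all-filter)
open import Data.Maybe using (Maybe; just; nothing)
open import Data.Nat as ℕ using (ℕ; zero; suc; NonZero)
open import Data.Nat.Induction using (<-rec)
import Data.Nat.Properties as ℕ
open import Data.Product using (∃; _×_; _,_; proj₁; proj₂)
import Data.Sign as Sign
open import Data.Sum using (_⊎_; inj₁; inj₂)
open import Data.Unit.Polymorphic using (⊤; tt)
open import Data.Vec as Vec using (Vec; []; _∷_; here; there)
import Data.Vec.Membership.Propositional as Vec
open import Data.Vec.Membership.Propositional.Properties using (∈-allFin⁺)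
import Data.Vec.Properties as Vec
open import Data.Vec.Relation.Unary.Any using (here; there)
open import Data.Vec.Functional as Vector using (Vector; tail; removeAt)
import Data.Vec.Functional.Properties as Vector
open import Function using (_∘_)
open import Level as Level using (_⊔_)
open import Relation.Binary using (IsDecTotalOrder)
open import Relation.Binary.PropositionalEquality as ≡ using (_≡_; _≢_)
import Relation.Binary.Reasoning.Setoid as SetoidReasoning
open import Relation.Nullary using (¬_; Dec; yes; no; does; contradiction)
open import Relation.Nullary.Decidable using (¬?; dec-yes; dec-no; decidable-stable)
open import Relation.Unary using (Pred; Decidable)

-- If U is k-independent, then Aᵏ has no off-diagonal entries inside U, so on the
-- |U|-dimensional space of vectors supported in U the form of Aᵏ - w is diagonal
-- and nonnegative.  In an orthogonal basis of eigenvectors the same form has the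
-- coefficients λᵢᵏ - w, up to positive factors.  If fewer than |U| of these were
-- nonnegative, some nonzero vector supported in U would be orthogonal to the
-- corresponding eigenvectors, and the form would be negative at it.  W is treated
-- in the same way with the opposite sign.
--
-- The field need not contain square roots, so the eigenbasis is orthogonal but not
-- normalised.  It is obtained by deflation: the pencil xS - B of the Gram matrices
-- of the remaining vectors for the forms x·y and x·Ay has determinant c ∏ (x - λᵢ),
-- a root gives an eigenvector in their span, and after orthogonalisation its factor
-- cancels.

-- The spectrum is given only through the values of a determinant, so eigenvectors must be extracted
-- from determinants. This calls for two facts about the Laplace expansion: multiplicativity,
-- obtained from the uniqueness of alternating forms, and the existence of a kernel vector for a
-- singular matrix. Carrying the whole product along, and not one root at a time, settles
-- multiplicities: each entry of the list yields its own vector, orthogonal to the earlier ones. A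
-- kernel vector of the pencil only makes λv - Av orthogonal to the remaining span; symmetry of A
-- and the definiteness of sums of squares turn this into λv = Av. The factor x - λ is zero at x = λ
-- and cannot be divided out pointwise there. Both sides are therefore treated as polynomial
-- functions, over a field that its order forces to have characteristic zero. The final comparison
-- ends in two nonnegative sums with total zero. Strictness is available exactly at the eigenvalues
-- left uncounted, which is enough to make the vector orthogonal to the whole eigenbasis.

-- Ring solver with integer constants over an arbitrary commutative ring.

module ℤSolver {c ℓ} (R : CommutativeRing c ℓ) where
  open CommutativeRing R
  open RingProperties ring using (-0#≈0#; -‿involutive; -‿distribˡ-*; -‿distribʳ-*)
  open AbelianGroupProperties +-abelianGroup using (⁻¹-∙-comm)
  open MonoidMult +-monoid using (1+×; ×-homo-+) renaming (_×_ to _·_)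
  open SemiringMult semiring using (×1-homo-*)
  open SetoidReasoning setoid

  -- The optimised multiple makes `1 · 1#` reduce to `1#`, so that the constant `con (ℤ.+ 1)`
  -- denotes `1#` itself in solved equations.
  fromℤ : ℤ → Carrier
  fromℤ (ℤ.+ n)     = n · 1#
  fromℤ (ℤ.-[1+ n ]) = - (suc n · 1#)

  fromℤ-neg : ∀ i → fromℤ (ℤ.- i) ≈ - fromℤ i
  fromℤ-neg (ℤ.+ zero)    = sym -0#≈0#
  fromℤ-neg (ℤ.+ (suc n)) = refl
  fromℤ-neg (ℤ.-[1+ n ])  = sym (-‿involutive _)

  cancel : ∀ a b c → (a + b) - (a + c) ≈ b - c
  cancel a b c = begin
    (a + b) - (a + c)       ≈⟨ +-cong (+-comm a b) (sym (⁻¹-∙-comm a c)) ⟩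
    (b + a) + (- a - c)     ≈⟨ +-assoc b a _ ⟩
    b + (a + (- a - c))     ≈⟨ +-congˡ (sym (+-assoc a (- a) (- c))) ⟩
    b + ((a - a) - c)       ≈⟨ +-congˡ (+-congʳ (-‿inverseʳ a)) ⟩
    b + (0# - c)            ≈⟨ +-congˡ (+-identityˡ _) ⟩
    b - c                   ∎

  fromℤ-⊖ : ∀ m n → fromℤ (m ℤ.⊖ n) ≈ (m · 1#) - (n · 1#)
  fromℤ-⊖ zero zero = sym (-‿inverseʳ 0#)
  fromℤ-⊖ zero (suc n) = sym (+-identityˡ _)
  fromℤ-⊖ (suc m) zero = sym (trans (+-congˡ -0#≈0#) (+-identityʳ _))
  fromℤ-⊖ (suc m) (suc n) = begin
    fromℤ (suc m ℤ.⊖ suc n)               ≡⟨ ≡.cong fromℤ (ℤ.[1+m]⊖[1+n]≡m⊖n m n) ⟩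
    fromℤ (m ℤ.⊖ n)                       ≈⟨ fromℤ-⊖ m n ⟩
    (m · 1#) - (n · 1#)                   ≈⟨ cancel 1# _ _ ⟨
    (1# + m · 1#) - (1# + n · 1#)         ≈⟨ +-cong (1+× m 1#) (-‿cong (1+× n 1#)) ⟨
    (suc m · 1#) - (suc n · 1#)           ∎

  fromℤ-+ : ∀ i j → fromℤ (i ℤ.+ j) ≈ fromℤ i + fromℤ j
  fromℤ-+ (ℤ.+ m)      (ℤ.+ n)      = ×-homo-+ 1# m n
  fromℤ-+ (ℤ.+ m)      (ℤ.-[1+ n ]) = fromℤ-⊖ m (suc n)
  fromℤ-+ (ℤ.-[1+ m ]) (ℤ.+ n)      = trans (fromℤ-⊖ n (suc m)) (+-comm _ _)
  fromℤ-+ (ℤ.-[1+ m ]) (ℤ.-[1+ n ]) = begin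
    - (suc (suc (m ℕ.+ n)) · 1#)         ≡⟨ ≡.cong (λ l → - (suc l · 1#)) (ℕ.+-suc m n) ⟨
    - ((suc m ℕ.+ suc n) · 1#)           ≈⟨ -‿cong (×-homo-+ 1# (suc m) (suc n)) ⟩
    - (suc m · 1# + suc n · 1#)          ≈⟨ ⁻¹-∙-comm _ _ ⟨
    - (suc m · 1#) + - (suc n · 1#)      ∎

  fromℤ-* : ∀ i j → fromℤ (i ℤ.* j) ≈ fromℤ i * fromℤ j
  fromℤ-* (ℤ.+ m)      (ℤ.+ n)      = begin
    fromℤ (Sign.+ ℤ.◃ m ℕ.* n)        ≡⟨ ≡.cong fromℤ (ℤ.+◃n≡+n (m ℕ.* n)) ⟩
    (m ℕ.* n) · 1#                    ≈⟨ ×1-homo-* m n ⟩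
    (m · 1#) * (n · 1#)               ∎
  fromℤ-* (ℤ.+ m)      (ℤ.-[1+ n ]) = begin
    fromℤ (Sign.- ℤ.◃ m ℕ.* suc n)    ≡⟨ ≡.cong fromℤ (ℤ.-◃n≡-n (m ℕ.* suc n)) ⟩
    fromℤ (ℤ.- (ℤ.+ (m ℕ.* suc n)))   ≈⟨ fromℤ-neg (ℤ.+ (m ℕ.* suc n)) ⟩
    - ((m ℕ.* suc n) · 1#)            ≈⟨ -‿cong (×1-homo-* m (suc n)) ⟩
    - ((m · 1#) * (suc n · 1#))       ≈⟨ -‿distribʳ-* _ _ ⟩
    (m · 1#) * - (suc n · 1#)         ∎
  fromℤ-* (ℤ.-[1+ m ]) (ℤ.+ n)      = begin
    fromℤ (Sign.- ℤ.◃ suc m ℕ.* n)    ≡⟨ ≡.cong fromℤ (ℤ.-◃n≡-n (suc m ℕ.* n)) ⟩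
    fromℤ (ℤ.- (ℤ.+ (suc m ℕ.* n)))   ≈⟨ fromℤ-neg (ℤ.+ (suc m ℕ.* n)) ⟩
    - ((suc m ℕ.* n) · 1#)            ≈⟨ -‿cong (×1-homo-* (suc m) n) ⟩
    - ((suc m · 1#) * (n · 1#))       ≈⟨ -‿distribˡ-* _ _ ⟩
    - (suc m · 1#) * (n · 1#)         ∎
  fromℤ-* (ℤ.-[1+ m ]) (ℤ.-[1+ n ]) = begin
    (suc m ℕ.* suc n) · 1#            ≈⟨ ×1-homo-* (suc m) (suc n) ⟩
    (suc m · 1#) * (suc n · 1#)       ≈⟨ -‿involutive _ ⟨
    - - ((suc m · 1#) * (suc n · 1#)) ≈⟨ -‿cong (-‿distribˡ-* _ _) ⟩
    - (- (suc m · 1#) * (suc n · 1#)) ≈⟨ -‿distribʳ-* _ _ ⟩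
    - (suc m · 1#) * - (suc n · 1#)   ∎

  private
    homomorphism : ℤ.+-*-rawRing ACR.-Raw-AlmostCommutative⟶ ACR.fromCommutativeRing R
    homomorphism = record
      { ⟦_⟧    = fromℤ
      ; +-homo = fromℤ-+
      ; *-homo = fromℤ-*
      ; -‿homo = fromℤ-neg
      ; 0-homo = refl
      ; 1-homo = refl
      }

    equal? : ∀ i j → Maybe (fromℤ i ≈ fromℤ j)
    equal? i j with i ℤ.≟ j
    ... | yes ≡.refl = just refl
    ... | no _       = nothing

  open RingSolver ℤ.+-*-rawRing (ACR.fromCommutativeRing R) homomorphism equal? public

-- Determinants as alternating multilinear forms.

module Determinant {c ℓ} (R : CommutativeRing c ℓ) where
  open CommutativeRing R hiding (zero)
  open RawSemiringDefs (Semiring.rawSemiring semiring) using (_^_)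
  open RingProperties ring using (-1*x≈-x; -0#≈0#)
  open SemiringSum semiring using (sum; sum-cong-≋; *-distribˡ-sum)
  open SemiringMatrix semiring using (_⊗_)
  open CharPoly R using (det)
  open ℤSolver R using (solve; _:=_; _:+_; _:*_; _:-_; :-_; con)
  open SetoidReasoning setoid

  private
    variable
      k m n : ℕ

  -- Vectors are functions, and a form on them need not respect pointwise `_≈_` by itself; hence the
  -- field `cong`.
  record IsLinear (h : Vector Carrier m → Carrier) : Set (c ⊔ ℓ) where
    field
      cong   : ∀ {x y} → (∀ i → x i ≈ y i) → h x ≈ h y
      linear : ∀ a x y → h (λ i → a * x i + y i) ≈ a * h x + h y

    zero-homo : h (λ _ → 0#) ≈ 0#
    zero-homo = begin
      h (λ _ → 0#)                                         ≈⟨ cong (λ _ → sym (trans (+-identityʳ _) (zeroʳ _))) ⟩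
      h (λ _ → - 1# * 0# + 0#)                             ≈⟨ linear (- 1#) _ _ ⟩
      - 1# * h (λ _ → 0#) + h (λ _ → 0#)                   ≈⟨ +-congʳ (-1*x≈-x _) ⟩
      - h (λ _ → 0#) + h (λ _ → 0#)                        ≈⟨ -‿inverseˡ _ ⟩
      0#                                                   ∎

  -- Concerns only the first two arguments; later neighbours are reached by the recursion of
  -- `Alternating`. A form of one argument carries no condition.
  VanishesOnRepeat : (Vec (Vector Carrier m) (suc n) → Carrier) → Set (c ⊔ ℓ)
  VanishesOnRepeat {n = zero}  f = ⊤
  VanishesOnRepeat {n = suc n} f = ∀ x d → f (x ∷ x ∷ d) ≈ 0#

  -- Multilinear, and zero when two neighbouring arguments agree.
  Alternating : (Vec (Vector Carrier m) n → Carrier) → Set (c ⊔ ℓ)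
  Alternating {n = zero}  f = ⊤
  Alternating {n = suc n} f =
    (∀ d → IsLinear (λ x → f (x ∷ d))) × VanishesOnRepeat f × (∀ x → Alternating (λ d → f (x ∷ d)))

  alternating-cong : {f : Vec (Vector Carrier m) n → Carrier} → Alternating f →
    ∀ {C D : Fin n → Vector Carrier m} → (∀ j i → C j i ≈ D j i) →
    f (Vec.tabulate C) ≈ f (Vec.tabulate D)
  alternating-cong {n = zero}  alt eq = refl
  alternating-cong {n = suc n} (lin , _ , alt) eq =
    trans (IsLinear.cong (lin _) (eq zero)) (alternating-cong (alt _) (eq ∘ suc))

  -- Polarisation: the value at (x + y, x + y) is zero, and of its four terms the two with a
  -- repeated argument are zero as well.
  swap : {f : Vec (Vector Carrier m) (suc (suc n)) → Carrier} → Alternating f →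
    ∀ x y d → f (x ∷ y ∷ d) ≈ - f (y ∷ x ∷ d)
  swap {f = f} (lin , rep , alt) x y d = begin
    f (x ∷ y ∷ d)
      ≈⟨ solve 4 (λ xx xy yx yy → xy := (con (ℤ.+ 1) :* (con (ℤ.+ 1) :* xx :+ xy)
           :+ (con (ℤ.+ 1) :* yx :+ yy)) :- xx :- yy :- yx) refl _ _ _ _ ⟩
    1# * (1# * f (x ∷ x ∷ d) + f (x ∷ y ∷ d)) + (1# * f (y ∷ x ∷ d) + f (y ∷ y ∷ d))
      - f (x ∷ x ∷ d) - f (y ∷ y ∷ d) - f (y ∷ x ∷ d)
      ≈⟨ +-congʳ (+-cong (+-cong expand (-‿cong (rep x d))) (-‿cong (rep y d))) ⟩
    0# - 0# - 0# - f (y ∷ x ∷ d)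
      ≈⟨ solve 1 (λ yx → con (ℤ.+ 0) :- con (ℤ.+ 0) :- con (ℤ.+ 0) :- yx := :- yx) refl _ ⟩
    - f (y ∷ x ∷ d) ∎
    where
    s = λ i → 1# * x i + y i
    expand : 1# * (1# * f (x ∷ x ∷ d) + f (x ∷ y ∷ d)) + (1# * f (y ∷ x ∷ d) + f (y ∷ y ∷ d)) ≈ 0#
    expand = begin
      _ ≈⟨ +-cong (*-congˡ (IsLinear.linear (proj₁ (alt x) d) 1# x y)) (IsLinear.linear (proj₁ (alt y) d) 1# x y) ⟨
      1# * f (x ∷ s ∷ d) + f (y ∷ s ∷ d) ≈⟨ IsLinear.linear (lin (s ∷ d)) 1# x y ⟨
      f (s ∷ s ∷ d)                      ≈⟨ rep s d ⟩
      0#                                 ∎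

  -- Laplace expansion along the first row of a matrix given by its columns; g
  -- plays the part of the determinant of the minors.
  laplace : (Vec (Vector Carrier m) n → Carrier) → Vec (Vector Carrier (suc m)) (suc n) → Carrier
  laplace {n = zero}  g (c ∷ []) = c zero * g []
  laplace {n = suc n} g (c ∷ cs) = c zero * g (Vec.map tail cs) - laplace (λ d → g (tail c ∷ d)) cs

  laplace-cong : {g h : Vec (Vector Carrier m) n → Carrier} → (∀ d → g d ≈ h d) →
    ∀ cs → laplace g cs ≈ laplace h cs
  laplace-cong {n = zero}  eq (c ∷ []) = *-congˡ (eq [])
  laplace-cong {n = suc n} eq (c ∷ cs) = +-cong (*-congˡ (eq _)) (-‿cong (laplace-cong (λ d → eq (_ ∷ d)) cs))

  -- `laplace` absorbs the tail of a column into `g`, so linearity in a column comes down to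
  -- linearity in `g`.
  laplace-linear : ∀ a (g h : Vec (Vector Carrier m) n → Carrier) cs →
    laplace (λ d → a * g d + h d) cs ≈ a * laplace g cs + laplace h cs
  laplace-linear {n = zero} a g h (c ∷ []) =
    solve 4 (λ a c x y → c :* (a :* x :+ y) := a :* (c :* x) :+ c :* y) refl _ _ _ _
  laplace-linear {n = suc n} a g h (c ∷ cs) = trans
    (+-congˡ (-‿cong (laplace-linear a _ _ cs)))
    (solve 6 (λ a c x y l r → c :* (a :* x :+ y) :- (a :* l :+ r) := a :* (c :* x :- l) :+ (c :* y :- r))
      refl _ _ _ _ _ _)

  laplace-vanish : {g : Vec (Vector Carrier m) n → Carrier} → (∀ d → g d ≈ 0#) → ∀ cs → laplace g cs ≈ 0#
  laplace-vanish {n = zero}  eq (c ∷ []) = trans (*-congˡ (eq [])) (zeroʳ _)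
  laplace-vanish {n = suc n} eq (c ∷ cs) = trans
    (+-cong (trans (*-congˡ (eq _)) (zeroʳ _)) (-‿cong (laplace-vanish (λ d → eq (_ ∷ d)) cs)))
    (-‿inverseʳ 0#)

  laplace-scale : ∀ (g : Vec (Vector Carrier m) n → Carrier) a cs →
    laplace (λ d → g d * a) cs ≈ laplace g cs * a
  laplace-scale g a cs = begin
    laplace (λ d → g d * a) cs        ≈⟨ laplace-cong (λ d → trans (*-comm _ _) (sym (+-identityʳ _))) cs ⟩
    laplace (λ d → a * g d + 0#) cs   ≈⟨ laplace-linear a g (λ _ → 0#) cs ⟩
    a * laplace g cs + laplace (λ _ → 0#) cs ≈⟨ +-cong (*-comm _ _) (laplace-vanish (λ _ → refl) cs) ⟩
    laplace g cs * a + 0#             ≈⟨ +-identityʳ _ ⟩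
    laplace g cs * a                  ∎

  laplace-neg : ∀ (g : Vec (Vector Carrier m) n → Carrier) cs →
    laplace (λ d → - g d) cs ≈ - laplace g cs
  laplace-neg g cs = begin
    laplace (λ d → - g d) cs ≈⟨ laplace-cong (λ d → solve 1 (λ x → :- x := x :* (:- con (ℤ.+ 1))) refl _) cs ⟩
    laplace (λ d → g d * - 1#) cs ≈⟨ laplace-scale g (- 1#) cs ⟩
    laplace g cs * - 1#           ≈⟨ trans (*-comm _ _) (-1*x≈-x _) ⟩
    - laplace g cs                ∎

  -- Fixing the first column of a Laplace expansion leaves a difference of this shape.
  alternating-minus : ∀ a {f g : Vec (Vector Carrier m) n → Carrier} → Alternating f → Alternating g →
    Alternating (λ d → a * f d - g d)
  alternating-minus {n = zero} a _ _ = tt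
  alternating-minus {m = m} {n = suc n} a {f} {g} (linf , repf , altf) (ling , repg , altg) =
    lin , rep n repf repg , λ x → alternating-minus a (altf x) (altg x)
    where
    lin : ∀ d → IsLinear (λ x → a * f (x ∷ d) - g (x ∷ d))
    lin d = record
      { cong   = λ eq → +-cong (*-congˡ (IsLinear.cong (linf d) eq)) (-‿cong (IsLinear.cong (ling d) eq))
      ; linear = λ b x y → trans
          (+-cong (*-congˡ (IsLinear.linear (linf d) b x y)) (-‿cong (IsLinear.linear (ling d) b x y)))
          (solve 6 (λ a b fx fy gx gy → a :* (b :* fx :+ fy) :- (b :* gx :+ gy)
             := b :* (a :* fx :- gx) :+ (a :* fy :- gy)) refl _ _ _ _ _ _)
      }
    rep : ∀ n {f g : Vec (Vector Carrier m) (suc n) → Carrier} →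
      VanishesOnRepeat f → VanishesOnRepeat g → VanishesOnRepeat (λ d → a * f d - g d)
    rep zero    _ _ = tt
    rep (suc n) repf repg x d = trans (+-cong (trans (*-congˡ (repf x d)) (zeroʳ _)) (-‿cong (repg x d))) (-‿inverseʳ 0#)

  alternating-tail : {f : Vec (Vector Carrier m) n → Carrier} → Alternating f →
    Alternating (λ d → f (Vec.map tail d))
  alternating-tail {n = zero} _ = tt
  alternating-tail {m = m} {n = suc n} {f} (lin , rep , alt) =
    lin′ , rep′ n rep , λ x → alternating-tail (alt (tail x))
    where
    lin′ : ∀ d → IsLinear (λ x → f (tail x ∷ Vec.map tail d))
    lin′ d = record
      { cong   = λ eq → IsLinear.cong (lin _) (eq ∘ suc)
      ; linear = λ a x y → IsLinear.linear (lin _) a (tail x) (tail y)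
      }
    rep′ : ∀ n {f : Vec (Vector Carrier m) (suc n) → Carrier} →
      VanishesOnRepeat f → VanishesOnRepeat (λ d → f (Vec.map tail d))
    rep′ zero    _     = tt
    rep′ (suc n) rep x d = rep (tail x) (Vec.map tail d)

  laplace-alternating : {g : Vec (Vector Carrier m) n → Carrier} → Alternating g → Alternating (laplace g)
  laplace-alternating {m = m} {n = n} {g = g} alt = lin n alt , rep n alt , rest n alt
    where
    lin : ∀ n {g : Vec (Vector Carrier m) n → Carrier} → Alternating g → ∀ d → IsLinear (λ x → laplace g (x ∷ d))
    lin zero alt [] = record
      { cong   = λ eq → *-congʳ (eq zero)
      ; linear = λ a x y → solve 4 (λ a x y g → (a :* x :+ y) :* g := a :* (x :* g) :+ y :* g) refl _ _ _ _
      }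
    lin (suc n) {g} (lin , _ , _) d = record
      { cong   = λ eq → +-cong (*-congʳ (eq zero)) (-‿cong (laplace-cong (λ d → IsLinear.cong (lin d) (eq ∘ suc)) _))
      ; linear = λ a x y → trans
          (+-congˡ (-‿cong (trans (laplace-cong (λ d → IsLinear.linear (lin d) a (tail x) (tail y)) d) (laplace-linear a (λ e → g (tail x ∷ e)) (λ e → g (tail y ∷ e)) d))))
          (solve 6 (λ a x y g l r → (a :* x :+ y) :* g :- (a :* l :+ r) := a :* (x :* g :- l) :+ (y :* g :- r))
            refl _ _ _ _ _ _)
      }
    rep : ∀ n {g : Vec (Vector Carrier m) n → Carrier} → Alternating g → VanishesOnRepeat (laplace g)
    rep zero    _ = tt
    rep (suc zero)    _ x [] = -‿inverseʳ _
    -- The two leading terms are equal with opposite signs; the remainder expands a form whose first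
    -- two arguments are both `tail x`.
    rep (suc (suc n)) (_ , rep , _) x d = trans
      (+-congˡ (-‿cong (trans (+-congˡ (trans (-‿cong (laplace-vanish (rep (tail x)) d)) -0#≈0#)) (+-identityʳ _))))
      (-‿inverseʳ _)
    rest : ∀ n {g : Vec (Vector Carrier m) n → Carrier} → Alternating g → ∀ x → Alternating (λ d → laplace g (x ∷ d))
    rest zero    _ x = tt
    rest (suc n) {g} alt@(_ , _ , alts) x =
      alternating-minus (x zero) {f = λ d → g (Vec.map tail d)}
        (alternating-tail {f = g} alt) (laplace-alternating {n = n} (alts (tail x)))

  detC : Vec (Vector Carrier n) n → Carrier
  detC {n = zero}  [] = 1#
  detC {n = suc n} cs = laplace detC cs

  detC-alternating : ∀ n → Alternating (detC {n})
  detC-alternating zero    = tt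
  detC-alternating (suc n) = laplace-alternating (detC-alternating n)

  -- The alternating signs of the row expansion become the nested subtractions of `laplace`: passing
  -- each column takes one factor `- 1#` out of the remaining sum.
  det≈detC : (M : Matrix Carrier n n) → det M ≈ detC (Vec.tabulate λ j i → M i j)
  det≈detC {n = zero}  M = refl
  det≈detC {n = suc n} M = trans
    (sum-cong-≋ λ j → *-congˡ {(- 1#) ^ Fin.toℕ j} (*-congˡ {M zero j} (det≈detC λ i → removeAt (tail M i) j)))
    (sum≈laplace detC λ j i → M i j)
    where
    sum≈laplace : ∀ {m n} (g : Vec (Vector Carrier m) n → Carrier) (C : Fin (suc n) → Vector Carrier (suc m)) →
      sum (λ j → (- 1#) ^ Fin.toℕ j * (C j zero * g (Vec.tabulate (tail ∘ removeAt C j)))) ≈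
      laplace g (Vec.tabulate C)
    sum≈laplace {n = zero}  g C = trans (+-identityʳ _) (*-identityˡ _)
    sum≈laplace {n = suc n} g C = +-cong
      (trans (*-identityˡ _) (*-congˡ (reflexive (≡.cong g (Vec.tabulate-∘ tail (tail C))))))
      (begin
        sum (λ j → (- 1# * (- 1#) ^ Fin.toℕ j) * t j)  ≈⟨ sum-cong-≋ {y = λ j → - 1# * ((- 1#) ^ Fin.toℕ j * t j)} (λ j → *-assoc _ _ _) ⟩
        sum (λ j → - 1# * ((- 1#) ^ Fin.toℕ j * t j))  ≈⟨ *-distribˡ-sum (- 1#) (λ j → (- 1#) ^ Fin.toℕ j * t j) ⟨
        - 1# * sum (λ j → (- 1#) ^ Fin.toℕ j * t j)    ≈⟨ -1*x≈-x _ ⟩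
        - sum (λ j → (- 1#) ^ Fin.toℕ j * t j)         ≈⟨ -‿cong (sum≈laplace (λ d → g (tail (C zero) ∷ d)) (tail C)) ⟩
        - laplace (λ d → g (tail (C zero) ∷ d)) (Vec.tabulate (tail C)) ∎)
      where
      t : Fin (suc n) → Carrier
      t j = C (suc j) zero * g (Vec.tabulate (tail ∘ removeAt C (suc j)))

  -- Multilinear expansion in `v`: terms containing `v` twice vanish, and bringing a single `v` to
  -- the front costs exactly the sign found in the Laplace expansion along the coefficients of `v`.
  expand : {f : Vec (Vector Carrier k) (suc n) → Carrier} → Alternating f →
    ∀ v (φ : Vector Carrier m → Vector Carrier k) cs →
    f (Vec.map (λ c i → c zero * v i + φ (tail c) i) cs) ≈
    f (Vec.map (φ ∘ tail) cs) + laplace (λ d → f (v ∷ Vec.map φ d)) cs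
  expand {n = zero} (lin , _) v φ (c ∷ []) = trans (IsLinear.linear (lin []) _ _ _) (+-comm _ _)
  expand {n = suc n} {f = f} alt@(lin , rep , alts) v φ (c ∷ cs) = begin
    f (ψ c ∷ Vec.map ψ cs)
      ≈⟨ IsLinear.linear (lin _) _ _ _ ⟩
    c zero * f (v ∷ Vec.map ψ cs) + f (φ (tail c) ∷ Vec.map ψ cs)
      ≈⟨ +-cong (*-congˡ (expand (alts v) v φ cs)) (expand (alts (φ (tail c))) v φ cs) ⟩
    c zero * (f (v ∷ Vec.map (φ ∘ tail) cs) + laplace (λ d → f (v ∷ v ∷ Vec.map φ d)) cs)
      + (f (Vec.map (φ ∘ tail) (c ∷ cs)) + laplace (λ d → f (φ (tail c) ∷ v ∷ Vec.map φ d)) cs)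
      ≈⟨ +-cong
           (*-congˡ (+-cong (reflexive (≡.cong (λ d → f (v ∷ d)) (Vec.map-∘ φ tail cs))) (laplace-vanish (λ d → rep v _) cs)))
           (+-congˡ (trans (laplace-cong (λ d → swap {f = f} alt (φ (tail c)) v (Vec.map φ d)) cs) (laplace-neg _ cs))) ⟩
    c zero * (f (v ∷ Vec.map φ (Vec.map tail cs)) + 0#)
      + (f (Vec.map (φ ∘ tail) (c ∷ cs)) - laplace (λ d → f (v ∷ φ (tail c) ∷ Vec.map φ d)) cs)
      ≈⟨ solve 4 (λ c x y l → c :* (x :+ con (ℤ.+ 0)) :+ (y :- l) := y :+ (c :* x :- l)) refl _ _ _ _ ⟩
    f (Vec.map (φ ∘ tail) (c ∷ cs)) + laplace (λ d → f (v ∷ Vec.map φ d)) (c ∷ cs) ∎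
    where
    ψ = λ c i → c zero * v i + φ (tail c) i

  combination : Vec (Vector Carrier k) n → Vector Carrier n → Vector Carrier k
  combination []       c i = 0#
  combination (v ∷ vs) c i = c zero * v i + combination vs (tail c) i

  -- Expanding in the first vector leaves combinations of one vector fewer, with as many arguments
  -- or one fewer, so the arguments always outnumber the vectors. With no vectors left every
  -- argument is zero.
  vanishes-on-dependent : {f : Vec (Vector Carrier k) n → Carrier} → Alternating f →
    (vs : Vec (Vector Carrier k) m) → m ℕ.< n → ∀ cs → f (Vec.map (combination vs) cs) ≈ 0#
  vanishes-on-dependent (lin , _) [] (ℕ.s≤s _) (c ∷ cs) = IsLinear.zero-homo (lin _)
  vanishes-on-dependent {n = suc n} {f = f} alt@(_ , _ , alts) (v ∷ vs) (ℕ.s≤s m<n) cs = trans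
    (expand alt v (combination vs) cs)
    (trans (+-cong
      (trans (reflexive (≡.cong f (Vec.map-∘ (combination vs) tail cs)))
             (vanishes-on-dependent {f = f} alt vs (ℕ.m<n⇒m<1+n m<n) (Vec.map tail cs)))
      (laplace-vanish (vanishes-on-dependent (alts v) vs m<n) cs))
      (+-identityˡ 0#))

  -- In the expansion the part without `v` has one vector too few and vanishes; the other part is,
  -- by induction, the recursion that defines `detC`.
  alternating-unique : {f : Vec (Vector Carrier k) n → Carrier} → Alternating f →
    ∀ vs cs → f (Vec.map (combination vs) cs) ≈ detC cs * f vs
  alternating-unique {n = zero}  alt [] [] = sym (*-identityˡ _)
  alternating-unique {n = suc n} {f = f} alt@(_ , _ , alts) (v ∷ vs) cs = begin
    f (Vec.map (combination (v ∷ vs)) cs)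
      ≈⟨ expand alt v (combination vs) cs ⟩
    f (Vec.map (combination vs ∘ tail) cs) + laplace (λ d → f (v ∷ Vec.map (combination vs) d)) cs
      ≈⟨ +-cong
           (trans (reflexive (≡.cong f (Vec.map-∘ (combination vs) tail cs)))
                  (vanishes-on-dependent alt vs (ℕ.n<1+n n) (Vec.map tail cs)))
           (trans (laplace-cong (alternating-unique (alts v) vs) cs) (laplace-scale detC _ cs)) ⟩
    0# + detC cs * f (v ∷ vs)
      ≈⟨ +-identityˡ _ ⟩
    detC cs * f (v ∷ vs) ∎

  det-cong : {M N : Matrix Carrier n n} → (∀ i j → M i j ≈ N i j) → det M ≈ det N
  det-cong {n = n} {M} {N} eq = begin
    det M                               ≈⟨ det≈detC M ⟩
    detC (Vec.tabulate λ j i → M i j)   ≈⟨ alternating-cong (detC-alternating n) (λ j i → eq i j) ⟩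
    detC (Vec.tabulate λ j i → N i j)   ≈⟨ det≈detC N ⟨
    det N                               ∎

  -- Uniqueness applied to `detC` itself: the columns of `M ⊗ N` are combinations of the columns of
  -- `M`, with the columns of `N` as coefficients.
  det-⊗ : (M N : Matrix Carrier n n) → det (M ⊗ N) ≈ det N * det M
  det-⊗ {n = n} M N = begin
    det (M ⊗ N)
      ≈⟨ det≈detC (M ⊗ N) ⟩
    detC (Vec.tabulate λ j i → (M ⊗ N) i j)
      ≈⟨ alternating-cong (detC-alternating n) (λ j i → sym (combination-tabulate (λ l i → M i l) (λ l → N l j) i)) ⟩
    detC (Vec.tabulate λ j → combination columns λ l → N l j)
      ≡⟨ ≡.cong detC (Vec.tabulate-∘ (combination columns) (λ j l → N l j)) ⟩
    detC (Vec.map (combination columns) (Vec.tabulate λ j l → N l j))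
      ≈⟨ alternating-unique (detC-alternating n) columns (Vec.tabulate λ j l → N l j) ⟩
    detC (Vec.tabulate λ j l → N l j) * detC columns
      ≈⟨ *-cong (det≈detC N) (det≈detC M) ⟨
    det N * det M ∎
    where
    columns = Vec.tabulate λ j i → M i j
    combination-tabulate : ∀ {k n} (C : Fin n → Vector Carrier k) c i →
      combination (Vec.tabulate C) c i ≈ sum (λ l → C l i * c l)
    combination-tabulate {n = zero}  C c i = refl
    combination-tabulate {n = suc n} C c i = +-cong (*-comm _ _) (combination-tabulate (tail C) (tail c) i)

-- Elimination and the existence of kernel vectors.

module LinearAlgebra {c ℓ₁ ℓ₂} (F : OrderedField c ℓ₁ ℓ₂) where
  open OrderedField F hiding (zero)
  open RawSemiringDefs (Semiring.rawSemiring semiring) using (_^_)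
  open SemiringSum semiring using (sum; sum-cong-≋; sum-remove; sum-replicate-zero; ∑-distrib-+; *-distribˡ-sum)
  open SemiringMatrix semiring using (𝟙; _⊗_)
  open CharPoly commutativeRing using (det)
  open Determinant commutativeRing using (det-cong; det-⊗)
  open ℤSolver commutativeRing using (solve; _:=_; _:+_; _:*_; _:-_; :-_; con)
  open SetoidReasoning setoid

  private
    variable
      m n : ℕ

  *-cancel-zero : ∀ {x y} → x ≉ 0# → x * y ≈ 0# → y ≈ 0#
  *-cancel-zero {x} {y} x≉0 xy≈0 with inverse x x≉0
  ... | x⁻¹ , xx⁻¹≈1 = begin
    y               ≈⟨ *-identityˡ y ⟨
    1# * y          ≈⟨ *-congʳ xx⁻¹≈1 ⟨
    (x * x⁻¹) * y   ≈⟨ solve 3 (λ x x⁻¹ y → x :* x⁻¹ :* y := x⁻¹ :* (x :* y)) refl _ _ _ ⟩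
    x⁻¹ * (x * y)   ≈⟨ *-congˡ xy≈0 ⟩
    x⁻¹ * 0#        ≈⟨ zeroʳ _ ⟩
    0#              ∎

  *-nonzero : ∀ {x y} → x ≉ 0# → y ≉ 0# → x * y ≉ 0#
  *-nonzero x≉0 y≉0 = y≉0 ∘ *-cancel-zero x≉0

  ^-nonzero : ∀ {x} → x ≉ 0# → ∀ k → x ^ k ≉ 0#
  ^-nonzero x≉0 zero    = 0≉1 ∘ sym
  ^-nonzero x≉0 (suc k) = *-nonzero x≉0 (^-nonzero x≉0 k)

  -1≉0 : - 1# ≉ 0#
  -1≉0 -1≈0 = 0≉1 (sym (trans (sym (+-identityʳ 1#)) (trans (+-congˡ (sym -1≈0)) (-‿inverseʳ 1#))))

  sum-zero : {t : Vector Carrier n} → (∀ i → t i ≈ 0#) → sum t ≈ 0#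
  sum-zero {n} eq = trans (sum-cong-≋ eq) (sum-replicate-zero n)

  sum-single : ∀ p (t : Vector Carrier n) → (∀ j → j ≢ p → t j ≈ 0#) → sum t ≈ t p
  sum-single {suc n} p t eq = trans (sum-remove t)
    (trans (+-congˡ (sum-zero λ j → eq (punchIn p j) (Fin.punchInᵢ≢i p j))) (+-identityʳ _))

  𝟙-diagonal : ∀ (i : Fin n) → 𝟙 i i ≈ 1#
  𝟙-diagonal i rewrite proj₂ (dec-yes (i Fin.≟ i) ≡.refl) = refl

  𝟙-off-diagonal : {i j : Fin n} → i ≢ j → 𝟙 i j ≈ 0#
  𝟙-off-diagonal {i = i} {j} i≢j rewrite dec-no (i Fin.≟ j) i≢j = refl

  infix 8 _∙_
  _∙_ : Vector Carrier n → Vector Carrier n → Carrier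
  x ∙ y = sum λ i → x i * y i

  ∙-cong : {x x′ y y′ : Vector Carrier n} → (∀ i → x i ≈ x′ i) → (∀ i → y i ≈ y′ i) → x ∙ y ≈ x′ ∙ y′
  ∙-cong eq eq′ = sum-cong-≋ λ i → *-cong (eq i) (eq′ i)

  ∙-comm : ∀ (x y : Vector Carrier n) → x ∙ y ≈ y ∙ x
  ∙-comm x y = sum-cong-≋ λ i → *-comm (x i) (y i)

  ∙-linearʳ : ∀ (x y z : Vector Carrier n) a → x ∙ (λ i → y i + a * z i) ≈ x ∙ y + a * x ∙ z
  ∙-linearʳ x y z a = begin
    sum (λ i → x i * (y i + a * z i))
      ≈⟨ sum-cong-≋ (λ i → solve 4 (λ x y z a → x :* (y :+ a :* z) := x :* y :+ a :* (x :* z)) refl (x i) (y i) (z i) a) ⟩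
    sum (λ i → x i * y i + a * (x i * z i))        ≈⟨ ∑-distrib-+ (λ i → x i * y i) (λ i → a * (x i * z i)) ⟩
    x ∙ y + sum (λ i → a * (x i * z i))            ≈⟨ +-congˡ (*-distribˡ-sum a (λ i → x i * z i)) ⟨
    x ∙ y + a * x ∙ z                              ∎

  ∙-𝟙 : ∀ (x : Vector Carrier n) p → x ∙ (λ i → 𝟙 i p) ≈ x p
  ∙-𝟙 x p = trans
    (sum-single p _ λ j j≢p → trans (*-congˡ (𝟙-off-diagonal j≢p)) (zeroʳ _))
    (trans (*-congˡ (𝟙-diagonal p)) (*-identityʳ _))

  HasKernel : Matrix Carrier m n → Set (c ⊔ ℓ₁)
  HasKernel M = ∃ λ y → (∃ λ p → y p ≉ 0#) × (∀ i → M i ∙ y ≈ 0#)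

  -- Solving the equation r ∙ y ≈ 0 for the unknown y p, where b is the inverse of r p.
  module Elimination {n} (r : Vector Carrier (suc n)) (p : Fin (suc n)) (b : Carrier) (rₚb≈1 : r p * b ≈ 1#) where

    substituted : Vector Carrier (suc n) → Vector Carrier n
    substituted s j = s (punchIn p j) + - (r (punchIn p j) * b) * s p

    extend : Vector Carrier n → Vector Carrier (suc n)
    extend y = Vector.insertAt y p (- (b * removeAt r p ∙ y))

    ∙-extend : ∀ s y → s ∙ extend y ≈ s p * - (b * removeAt r p ∙ y) + removeAt s p ∙ y
    ∙-extend s y = trans (sum-remove {i = p} (λ i → s i * extend y i)) (+-cong
      (*-congˡ (reflexive (Vector.insertAt-lookup y p _)))
      (sum-cong-≋ λ j → *-congˡ {s (punchIn p j)} (reflexive (Vector.insertAt-punchIn y p _ j))))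

    pivot∙extend : ∀ y → r ∙ extend y ≈ 0#
    pivot∙extend y = begin
      r ∙ extend y                  ≈⟨ ∙-extend r y ⟩
      r p * - (b * D) + D           ≈⟨ solve 3 (λ r b D → r :* :- (b :* D) :+ D := (con (ℤ.+ 1) :- r :* b) :* D) refl _ _ _ ⟩
      (1# - r p * b) * D            ≈⟨ *-congʳ (+-congˡ (-‿cong rₚb≈1)) ⟩
      (1# - 1#) * D                 ≈⟨ solve 1 (λ D → (con (ℤ.+ 1) :- con (ℤ.+ 1)) :* D := con (ℤ.+ 0)) refl _ ⟩
      0#                            ∎
      where D = removeAt r p ∙ y

    substituted∙ : ∀ s y → s ∙ extend y ≈ substituted s ∙ y
    substituted∙ s y = begin
      s ∙ extend y
        ≈⟨ ∙-extend s y ⟩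
      s p * - (b * removeAt r p ∙ y) + removeAt s p ∙ y
        ≈⟨ solve 4 (λ s b D E → s :* :- (b :* D) :+ E := E :+ :- (b :* s) :* D) refl _ _ _ _ ⟩
      removeAt s p ∙ y + - (b * s p) * removeAt r p ∙ y
        ≈⟨ +-cong (∙-comm (removeAt s p) y) (*-congˡ (∙-comm (removeAt r p) y)) ⟩
      y ∙ removeAt s p + - (b * s p) * y ∙ removeAt r p
        ≈⟨ ∙-linearʳ y (removeAt s p) (removeAt r p) (- (b * s p)) ⟨
      y ∙ (λ j → s (punchIn p j) + - (b * s p) * r (punchIn p j))
        ≈⟨ sum-cong-≋ (λ j → solve 5 (λ y s b sₚ r → y :* (s :+ :- (b :* sₚ) :* r) := (s :+ :- (r :* b) :* sₚ) :* y)
             refl (y j) (s (punchIn p j)) b (s p) (r (punchIn p j))) ⟩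
      substituted s ∙ y ∎

    kernel : (M : Matrix Carrier m (suc n)) → HasKernel (substituted ∘ M) →
      ∃ λ y → (∃ λ q → y q ≉ 0#) × r ∙ y ≈ 0# × (∀ i → M i ∙ y ≈ 0#)
    kernel M (y , (q , y≉0) , My≈0) =
      extend y ,
      (punchIn p q , λ eq → y≉0 (trans (reflexive (≡.sym (Vector.insertAt-punchIn y p _ q))) eq)) ,
      pivot∙extend y ,
      λ i → trans (substituted∙ (M i) y) (My≈0 i)

    clearingColumn : Fin n → Vector Carrier (suc n)
    clearingColumn j l = 𝟙 l (punchIn p j) + - (r (punchIn p j) * b) * 𝟙 l p

    -- Right multiplication by this matrix keeps column `p` and adds to each other column the
    -- multiple of it that clears the row `r`. Elimination thereby becomes a matrix product, to
    -- which `det-⊗` applies.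
    columnOperations : Matrix Carrier (suc n) (suc n)
    columnOperations i j = Vector.insertAt clearingColumn p (λ l → 𝟙 l p) j i

    ⊗-columnOperations-pivot : (M : Matrix Carrier m (suc n)) → ∀ i → M i ∙ (λ l → columnOperations l p) ≈ M i p
    ⊗-columnOperations-pivot M i = trans
      (∙-cong {x = M i} (λ _ → refl) λ l → reflexive (≡.cong (λ f → f l) (Vector.insertAt-lookup clearingColumn p (λ l → 𝟙 l p))))
      (∙-𝟙 (M i) p)

    ⊗-columnOperations : (M : Matrix Carrier m (suc n)) → ∀ i j →
      M i ∙ (λ l → columnOperations l (punchIn p j)) ≈ substituted (M i) j
    ⊗-columnOperations M i j = begin
      M i ∙ (λ l → columnOperations l (punchIn p j))
        ≈⟨ ∙-cong {x = M i} (λ _ → refl) (λ l → reflexive (≡.cong (λ f → f l) (Vector.insertAt-punchIn clearingColumn p (λ l → 𝟙 l p) j))) ⟩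
      M i ∙ (λ l → 𝟙 l (punchIn p j) + - (r (punchIn p j) * b) * 𝟙 l p)
        ≈⟨ ∙-linearʳ (M i) (λ l → 𝟙 l (punchIn p j)) (λ l → 𝟙 l p) (- (r (punchIn p j) * b)) ⟩
      M i ∙ (λ l → 𝟙 l (punchIn p j)) + - (r (punchIn p j) * b) * M i ∙ (λ l → 𝟙 l p)
        ≈⟨ +-cong (∙-𝟙 (M i) (punchIn p j)) (*-congˡ (∙-𝟙 (M i) p)) ⟩
      substituted (M i) j ∎

    substituted-pivot : ∀ j → substituted r j ≈ 0#
    substituted-pivot j = begin
      r (punchIn p j) + - (r (punchIn p j) * b) * r p
        ≈⟨ solve 3 (λ r b rₚ → r :+ :- (r :* b) :* rₚ := r :* (con (ℤ.+ 1) :- rₚ :* b)) refl _ _ _ ⟩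
      r (punchIn p j) * (1# - r p * b)   ≈⟨ *-congˡ (+-congˡ (-‿cong rₚb≈1)) ⟩
      r (punchIn p j) * (1# - 1#)        ≈⟨ *-congˡ (-‿inverseʳ 1#) ⟩
      r (punchIn p j) * 0#               ≈⟨ zeroʳ _ ⟩
      0#                                 ∎

    -- After the column operations the pivot is the only possibly nonzero entry of the first row, so
    -- the expansion is a sign times `r p` times the determinant on the left of the conclusion. The
    -- product inherits singularity from `M`.
    det-substituted : (M : Matrix Carrier (suc n) (suc n)) → (∀ j → M zero j ≈ r j) → r p ≉ 0# →
      det M ≈ 0# → det (substituted ∘ tail M) ≈ 0#
    det-substituted M M₀≈r rₚ≉0 detM≈0 = *-cancel-zero rₚ≉0 (*-cancel-zero (^-nonzero -1≉0 (Fin.toℕ p)) (begin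
      (- 1#) ^ Fin.toℕ p * (r p * det (substituted ∘ tail M))
        ≈⟨ *-congˡ (*-cong (trans (⊗-columnOperations-pivot M zero) (M₀≈r p))
             (det-cong λ i j → ⊗-columnOperations M (suc i) j)) ⟨
      t p
        ≈⟨ sum-single p t (λ j j≢p → trans (*-congˡ (trans (*-congʳ (rest j j≢p)) (zeroˡ _))) (zeroʳ _)) ⟨
      det (M ⊗ columnOperations)
        ≈⟨ det-⊗ M columnOperations ⟩
      det columnOperations * det M
        ≈⟨ trans (*-congˡ detM≈0) (zeroʳ _) ⟩
      0# ∎))
      where
      N = M ⊗ columnOperations
      t : Vector Carrier (suc n)
      t j = (- 1#) ^ Fin.toℕ j * (N zero j * det (λ i → removeAt (tail N i) j))
      rest : ∀ j → j ≢ p → N zero j ≈ 0#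
      rest j j≢p = begin
        N zero j                                        ≡⟨ ≡.cong (N zero) (Fin.punchIn-punchOut (j≢p ∘ ≡.sym)) ⟨
        N zero (punchIn p (Fin.punchOut (j≢p ∘ ≡.sym))) ≈⟨ ⊗-columnOperations M zero _ ⟩
        substituted (M zero) (Fin.punchOut (j≢p ∘ ≡.sym)) ≈⟨ +-cong (M₀≈r _) (*-congˡ (M₀≈r p)) ⟩
        substituted r (Fin.punchOut (j≢p ∘ ≡.sym))      ≈⟨ substituted-pivot _ ⟩
        0#                                              ∎

  nonzero-entry? : (x : Vector Carrier n) → (∃ λ p → x p ≉ 0#) ⊎ (∀ i → x i ≈ 0#)
  nonzero-entry? x with Fin.any? (λ p → ¬? (x p ≟ 0#))
  ... | yes found = inj₁ found
  ... | no none   = inj₂ λ i → decidable-stable (x i ≟ 0#) λ x≉0 → none (i , x≉0)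

  zero∙ : {x : Vector Carrier n} → (∀ i → x i ≈ 0#) → ∀ y → x ∙ y ≈ 0#
  zero∙ x≈0 y = sum-zero λ i → trans (*-congʳ (x≈0 i)) (zeroˡ _)

  -- A nonzero equation uses up one unknown and a zero equation none, so an unknown is still free
  -- when the equations are exhausted.
  kernel-underdetermined : m ℕ.< n → (M : Matrix Carrier m n) → HasKernel M
  kernel-underdetermined {zero}  {suc n} _ M = (λ _ → 1#) , (zero , 0≉1 ∘ sym) , λ ()
  kernel-underdetermined {suc m} {suc n} (ℕ.s≤s m<n) M with nonzero-entry? (M zero)
  ... | inj₂ M₀≈0 = let y , y≉0 , My≈0 = kernel-underdetermined (ℕ.m<n⇒m<1+n m<n) (tail M) in
    y , y≉0 , λ { zero → zero∙ M₀≈0 y ; (suc i) → My≈0 i }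
  ... | inj₁ (p , rₚ≉0) with inverse _ rₚ≉0
  ... | b , rₚb≈1 =
    let open Elimination (M zero) p b rₚb≈1
        y , y≉0 , ry≈0 , My≈0 = kernel (tail M) (kernel-underdetermined m<n (substituted ∘ tail M))
    in y , y≉0 , λ { zero → ry≈0 ; (suc i) → My≈0 i }

  -- A zero first row leaves fewer equations than unknowns; otherwise elimination passes to a
  -- smaller singular matrix. The descent cannot reach size 0, where the determinant is `1#`.
  kernel-singular : (M : Matrix Carrier n n) → det M ≈ 0# → HasKernel M
  kernel-singular {zero}  M detM≈0 = contradiction (sym detM≈0) 0≉1
  kernel-singular {suc n} M detM≈0 with nonzero-entry? (M zero)
  ... | inj₂ M₀≈0 = let y , y≉0 , My≈0 = kernel-underdetermined (ℕ.n<1+n n) (tail M) in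
    y , y≉0 , λ { zero → zero∙ M₀≈0 y ; (suc i) → My≈0 i }
  ... | inj₁ (p , rₚ≉0) with inverse _ rₚ≉0
  ... | b , rₚb≈1 =
    let open Elimination (M zero) p b rₚb≈1
        y , y≉0 , ry≈0 , My≈0 = kernel (tail M)
          (kernel-singular (substituted ∘ tail M) (det-substituted M (λ _ → refl) rₚ≉0 detM≈0))
    in y , y≉0 , λ { zero → ry≈0 ; (suc i) → My≈0 i }

-- Positivity, sums of squares and characteristic zero.

module Order {c ℓ₁ ℓ₂} (F : OrderedField c ℓ₁ ℓ₂) where
  open OrderedField F hiding (zero)
  open SemiringSum semiring using (sum)
  open LinearAlgebra F using (_∙_; *-cancel-zero)
  open Spectrum F using (fromℕ)
  open ℤSolver commutativeRing using (solve; _:=_; _:*_; _:-_; con)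
  open IsDecTotalOrder isDecTotalOrder public
    using (antisym; total) renaming (trans to ≤-trans; reflexive to ≤-reflexive)

  private
    variable
      n : ℕ

  ≤-resp : ∀ {w x y z} → w ≈ x → y ≈ z → w ≤ y → x ≤ z
  ≤-resp w≈x y≈z w≤y = ≤-trans (≤-reflexive (sym w≈x)) (≤-trans w≤y (≤-reflexive y≈z))

  0≤y-x : ∀ {x y} → x ≤ y → 0# ≤ y - x
  0≤y-x {x} x≤y = ≤-resp (-‿inverseʳ x) refl (+-mono-≤ x≤y (≤-reflexive refl))

  square-nonneg : ∀ x → 0# ≤ x * x
  square-nonneg x with total 0# x
  ... | inj₁ 0≤x = *-nonneg 0≤x 0≤x
  ... | inj₂ x≤0 = ≤-resp refl (solve 1 (λ x → (con (ℤ.+ 0) :- x) :* (con (ℤ.+ 0) :- x) := x :* x) refl x)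
    (*-nonneg (0≤y-x x≤0) (0≤y-x x≤0))

  square-zero : ∀ {x} → x * x ≈ 0# → x ≈ 0#
  square-zero {x} x²≈0 with x ≟ 0#
  ... | yes x≈0 = x≈0
  ... | no x≉0  = *-cancel-zero x≉0 x²≈0

  +-nonneg : ∀ {x y} → 0# ≤ x → 0# ≤ y → 0# ≤ x + y
  +-nonneg 0≤x 0≤y = ≤-resp (+-identityˡ 0#) refl (+-mono-≤ 0≤x 0≤y)

  +-nonneg-zeroˡ : ∀ {x y} → 0# ≤ x → 0# ≤ y → x + y ≈ 0# → x ≈ 0#
  +-nonneg-zeroˡ 0≤x 0≤y x+y≈0 = antisym
    (≤-resp (+-identityʳ _) x+y≈0 (+-mono-≤ (≤-reflexive refl) 0≤y)) 0≤x

  +-nonneg-zeroʳ : ∀ {x y} → 0# ≤ x → 0# ≤ y → x + y ≈ 0# → y ≈ 0#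
  +-nonneg-zeroʳ 0≤x 0≤y x+y≈0 = +-nonneg-zeroˡ 0≤y 0≤x (trans (+-comm _ _) x+y≈0)

  sum-nonneg : (t : Vector Carrier n) → (∀ i → 0# ≤ t i) → 0# ≤ sum t
  sum-nonneg {zero}  t 0≤t = ≤-reflexive refl
  sum-nonneg {suc n} t 0≤t = +-nonneg (0≤t zero) (sum-nonneg (tail t) (0≤t ∘ suc))

  sum-nonneg-zero : (t : Vector Carrier n) → (∀ i → 0# ≤ t i) → sum t ≈ 0# → ∀ i → t i ≈ 0#
  sum-nonneg-zero t 0≤t eq zero = +-nonneg-zeroˡ (0≤t zero) (sum-nonneg (tail t) (0≤t ∘ suc)) eq
  sum-nonneg-zero t 0≤t eq (suc i) = sum-nonneg-zero (tail t) (0≤t ∘ suc)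
    (+-nonneg-zeroʳ (0≤t zero) (sum-nonneg (tail t) (0≤t ∘ suc)) eq) i

  ∙-definite : (x : Vector Carrier n) → x ∙ x ≈ 0# → ∀ i → x i ≈ 0#
  ∙-definite x eq i = square-zero (sum-nonneg-zero (λ i → x i * x i) (λ i → square-nonneg (x i)) eq i)

  0≤1 : 0# ≤ 1#
  0≤1 = ≤-resp refl (*-identityˡ 1#) (square-nonneg 1#)

  fromℕ-nonneg : ∀ m → 0# ≤ fromℕ m
  fromℕ-nonneg zero    = ≤-reflexive refl
  fromℕ-nonneg (suc m) = +-nonneg 0≤1 (fromℕ-nonneg m)

  -- Characteristic zero follows from the order: a vanishing sum of nonnegative terms would force
  -- `1# ≈ 0#`.
  fromℕ-suc≉0 : ∀ m → fromℕ (suc m) ≉ 0#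
  fromℕ-suc≉0 m eq = 0≉1 (sym (+-nonneg-zeroˡ 0≤1 (fromℕ-nonneg m) eq))

  fromℕ-mono-≤ : ∀ {l m} → l ℕ.≤ m → fromℕ l ≤ fromℕ m
  fromℕ-mono-≤ {m = m} ℕ.z≤n = fromℕ-nonneg m
  fromℕ-mono-≤ (ℕ.s≤s l≤m)   = +-mono-≤ (≤-reflexive refl) (fromℕ-mono-≤ l≤m)

-- Polynomial functions and cancellation of a linear factor.

module PolynomialFunction {c ℓ₁ ℓ₂} (F : OrderedField c ℓ₁ ℓ₂) where
  open OrderedField F hiding (zero)
  open RawSemiringDefs (Semiring.rawSemiring semiring) using (_^_)
  open SemiringSum semiring using (sum)
  open MonoidMultiplication +-monoid using (×-homo-+)
  open CharPoly commutativeRing using (det)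
  open LinearAlgebra F using (*-cancel-zero)
  open Order F using (fromℕ-suc≉0)
  open Spectrum F using (fromℕ; product)
  open ℤSolver commutativeRing using (solve; _:=_; _:+_; _:*_; _:-_)
  open SetoidReasoning setoid

  private
    variable
      d n : ℕ
      f g : Carrier → Carrier

  -- Polynomial functions of degree less than d: f - f μ has the factor x - μ.
  IsPolynomial : ℕ → (Carrier → Carrier) → Set (c ⊔ ℓ₁)
  IsPolynomial zero    f = Level.Lift c (∀ x → f x ≈ 0#)
  IsPolynomial (suc d) f = ∀ μ → ∃ λ q → IsPolynomial d q × (∀ x → f x ≈ f μ + (x - μ) * q x)

  polynomial-resp : (∀ x → f x ≈ g x) → IsPolynomial d f → IsPolynomial d g
  polynomial-resp {d = zero}  f≈g (Level.lift f≈0) = Level.lift λ x → trans (sym (f≈g x)) (f≈0 x)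
  polynomial-resp {d = suc d} f≈g poly μ = let q , polyq , eq = poly μ in
    q , polyq , λ x → trans (sym (f≈g x)) (trans (eq x) (+-congʳ (f≈g μ)))

  polynomial-zero : ∀ d → IsPolynomial d (λ _ → 0#)
  polynomial-zero zero      = Level.lift λ _ → refl
  polynomial-zero (suc d) μ = _ , polynomial-zero d , λ x → sym (trans (+-congˡ (zeroʳ _)) (+-identityʳ _))

  polynomial-constant : ∀ d a → IsPolynomial (suc d) (λ _ → a)
  polynomial-constant d a μ = _ , polynomial-zero d , λ x → sym (trans (+-congˡ (zeroʳ _)) (+-identityʳ _))

  polynomial-suc : IsPolynomial d f → IsPolynomial (suc d) f
  polynomial-suc {zero}  (Level.lift f≈0) = polynomial-resp (λ x → sym (f≈0 x)) (polynomial-zero 1)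
  polynomial-suc {suc d} poly μ = let q , polyq , eq = poly μ in q , polynomial-suc polyq , eq

  polynomial-combine : ∀ a b → IsPolynomial d f → IsPolynomial d g → IsPolynomial d (λ x → a * f x + b * g x)
  polynomial-combine {zero}  a b (Level.lift f≈0) (Level.lift g≈0) = Level.lift λ x →
    trans (+-cong (trans (*-congˡ (f≈0 x)) (zeroʳ a)) (trans (*-congˡ (g≈0 x)) (zeroʳ b))) (+-identityʳ 0#)
  polynomial-combine {suc d} a b polyf polyg μ =
    let p , polyp , eqp = polyf μ
        q , polyq , eqq = polyg μ
    in _ , polynomial-combine a b polyp polyq , λ x → trans
      (+-cong (*-congˡ (eqp x)) (*-congˡ (eqq x)))
      (solve 7 (λ a b f g x p q → a :* (f :+ x :* p) :+ b :* (g :+ x :* q)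
        := (a :* f :+ b :* g) :+ x :* (a :* p :+ b :* q)) refl _ _ _ _ _ _ _)

  polynomial-linear-* : ∀ s t → IsPolynomial d f → IsPolynomial (suc d) (λ x → (x * s - t) * f x)
  polynomial-linear-* {zero} {f} s t (Level.lift f≈0) =
    polynomial-resp (λ x → sym (trans (*-congˡ (f≈0 x)) (zeroʳ _))) (polynomial-zero 1)
  polynomial-linear-* {suc d} {f} s t poly μ =
    let q , polyq , eq = poly μ
    -- The quotient comes from writing `x * s - t` as `(μ * s - t) + (x - μ) * s`.
    in _ , polynomial-combine s (μ * s - t) poly (polynomial-suc polyq) , λ x → trans
      (*-congˡ (eq x))
      (trans
        (solve 6 (λ x s t μ f q → (x :* s :- t) :* (f :+ (x :- μ) :* q)
           := (μ :* s :- t) :* f :+ (x :- μ) :* (s :* (f :+ (x :- μ) :* q) :+ (μ :* s :- t) :* q)) refl x s t μ (f μ) (q x))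
        (+-congˡ (*-congˡ (+-congʳ (*-congˡ (sym (eq x)))))))

  polynomial-sum : {f : Fin n → Carrier → Carrier} → (∀ i → IsPolynomial d (f i)) → IsPolynomial d (λ x → sum λ i → f i x)
  polynomial-sum {zero} {d} _ = polynomial-zero d
  polynomial-sum {suc n} {d} {f} poly = polynomial-resp
    (λ x → +-cong (*-identityˡ _) (*-identityˡ _))
    (polynomial-combine 1# 1# (poly zero) (polynomial-sum (poly ∘ suc)))

  polynomial-product : (μs : Vector Carrier n) → IsPolynomial (suc n) (λ x → product λ i → x - μs i)
  polynomial-product {zero}  μs = polynomial-constant 0 1#
  polynomial-product {suc n} μs = polynomial-resp (λ x → *-congʳ (+-congʳ (*-identityʳ x)))
    (polynomial-linear-* 1# (μs zero) (polynomial-product (tail μs)))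

  -- Every entry is linear in `x`, so each row of the expansion raises the degree bound by one.
  polynomial-det : (S B : Matrix Carrier n n) → IsPolynomial (suc n) (λ x → det λ i j → x * S i j - B i j)
  polynomial-det {zero}  S B = polynomial-constant 0 1#
  polynomial-det {suc n} S B = polynomial-sum {n = suc n} λ j → polynomial-resp
    (λ x → trans (+-congˡ (zeroˡ 0#)) (+-identityʳ _))
    (polynomial-combine ((- 1#) ^ Fin.toℕ j) 0#
      (polynomial-linear-* (S zero j) (B zero j)
        (polynomial-det (λ i → removeAt (tail S i) j) (λ i → removeAt (tail B i) j)))
      (polynomial-zero _))

  -- The quotient by `x - e 0` has the roots `e 1`, `e 2`, ... and a smaller degree bound.
  -- Distinctness is phrased by differences because these are the factors to be cancelled.
  polynomial-identity : IsPolynomial d f → (e : ℕ → Carrier) → (∀ {l m} → l ℕ.< m → e m - e l ≉ 0#) →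
    (∀ m → f (e m) ≈ 0#) → ∀ x → f x ≈ 0#
  polynomial-identity {zero}  (Level.lift f≈0) e _ _ = f≈0
  polynomial-identity {suc d} {f} poly e distinct root x = begin
    f x                            ≈⟨ eq x ⟩
    f (e 0) + (x - e 0) * q x      ≈⟨ +-cong (root 0) (*-congˡ (q≈0 x)) ⟩
    0# + (x - e 0) * 0#            ≈⟨ trans (+-identityˡ _) (zeroʳ _) ⟩
    0#                             ∎
    where
    q = proj₁ (poly (e 0))
    eq = proj₂ (proj₂ (poly (e 0)))
    q≈0 : ∀ x → q x ≈ 0#
    q≈0 = polynomial-identity (proj₁ (proj₂ (poly (e 0)))) (e ∘ suc) (distinct ∘ ℕ.s≤s) λ m →
      *-cancel-zero (distinct {0} {suc m} (ℕ.s≤s ℕ.z≤n)) (begin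
        (e (suc m) - e 0) * q (e (suc m))             ≈⟨ trans (+-congʳ (root 0)) (+-identityˡ _) ⟨
        f (e 0) + (e (suc m) - e 0) * q (e (suc m))   ≈⟨ eq (e (suc m)) ⟨
        f (e (suc m))                                 ≈⟨ root (suc m) ⟩
        0#                                            ∎)

  -- At `μ` the equation is void, so `f` is first shown to vanish at μ + 1, μ + 2, ...; these
  -- infinitely many roots then cover `μ` too.
  polynomial-cancel : IsPolynomial d f → ∀ μ → (∀ x → (x - μ) * f x ≈ 0#) → ∀ x → f x ≈ 0#
  polynomial-cancel {f = f} poly μ eq = polynomial-identity poly e distinct λ m →
    *-cancel-zero (fromℕ-suc≉0 m ∘ trans (sym (difference m))) (eq (e m))
    where
    e : ℕ → Carrier
    e m = μ + fromℕ (suc m)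
    difference : ∀ m → e m - μ ≈ fromℕ (suc m)
    difference m = solve 2 (λ μ a → μ :+ a :- μ := a) refl μ (fromℕ (suc m))
    distinct : ∀ {l m} → l ℕ.< m → e m - e l ≉ 0#
    distinct {l} {suc m} (ℕ.s≤s l≤m) eq = fromℕ-suc≉0 (m ℕ.∸ l) (trans (sym (begin
      e (suc m) - e l
        ≡⟨ ≡.cong (λ k → e k - e l) (≡.trans (≡.cong suc (≡.sym (ℕ.m+[n∸m]≡n l≤m))) (≡.sym (ℕ.+-suc l (m ℕ.∸ l)))) ⟩
      e (l ℕ.+ suc (m ℕ.∸ l)) - e l
        ≈⟨ +-congʳ (+-congˡ (×-homo-+ 1# (suc l) (suc (m ℕ.∸ l)))) ⟩
      (μ + (fromℕ (suc l) + fromℕ (suc (m ℕ.∸ l)))) - (μ + fromℕ (suc l))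
        ≈⟨ solve 3 (λ μ a b → (μ :+ (a :+ b)) :- (μ :+ a) := b) refl μ (fromℕ (suc l)) (fromℕ (suc (m ℕ.∸ l))) ⟩
      fromℕ (suc (m ℕ.∸ l)) ∎)) eq)

-- Orthogonal eigenvectors of a symmetric matrix by deflation.

module Diagonalisation {c ℓ₁ ℓ₂} (F : OrderedField c ℓ₁ ℓ₂) where
  open OrderedField F hiding (zero)
  open RingProperties ring using (-0#≈0#)
  open SemiringSum semiring using (sum; sum-cong-≋; *-distribˡ-sum; *-distribʳ-sum; ∑-comm)
  open SemiringMatrix semiring using (𝟙; _⊗_)
  open CharPoly commutativeRing using (det; charPoly)
  open Determinant commutativeRing using (det-cong; det-⊗)
  open LinearAlgebra F
  open Order F using (∙-definite)
  open PolynomialFunction F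
  open Spectrum F using (product; IsSpectrum)
  open ℤSolver commutativeRing using (solve; _:=_; _:+_; _:*_; _:-_; :-_; con)
  open SetoidReasoning setoid

  private
    variable
      m n : ℕ

  infixr 7 _*ᵛ_
  _*ᵛ_ : Matrix Carrier m n → Vector Carrier n → Vector Carrier m
  (M *ᵛ x) i = M i ∙ x

  ∙-linear₂ : ∀ a b (z x y : Vector Carrier n) → z ∙ (λ i → a * x i + b * y i) ≈ a * z ∙ x + b * z ∙ y
  ∙-linear₂ a b z x y = begin
    z ∙ (λ i → a * x i + b * y i)     ≈⟨ ∙-linearʳ z (λ i → a * x i) y b ⟩
    z ∙ (λ i → a * x i) + b * z ∙ y
      ≈⟨ +-congʳ (sum-cong-≋ λ i → solve 3 (λ a z x → z :* (a :* x) := a :* (z :* x)) refl a (z i) (x i)) ⟩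
    sum (λ i → a * (z i * x i)) + b * z ∙ y ≈⟨ +-congʳ (*-distribˡ-sum a (λ i → z i * x i)) ⟨
    a * z ∙ x + b * z ∙ y             ∎

  linearCombination : Vector Carrier m → Vector (Vector Carrier n) m → Vector Carrier n
  linearCombination a u i = a ∙ (λ j → u j i)

  ∙-linearCombination : ∀ (z : Vector Carrier n) a (u : Vector (Vector Carrier n) m) →
    z ∙ linearCombination a u ≈ a ∙ (λ j → z ∙ u j)
  ∙-linearCombination z a u = begin
    sum (λ i → z i * sum (λ j → a j * u j i))
      ≈⟨ sum-cong-≋ (λ i → *-distribˡ-sum (z i) (λ j → a j * u j i)) ⟩
    sum (λ i → sum (λ j → z i * (a j * u j i)))
      ≈⟨ ∑-comm (λ i j → z i * (a j * u j i)) ⟩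
    sum (λ j → sum (λ i → z i * (a j * u j i)))
      ≈⟨ sum-cong-≋ (λ j → trans
           (sum-cong-≋ (λ i → solve 3 (λ z a u → z :* (a :* u) := a :* (z :* u)) refl (z i) (a j) (u j i)))
           (sym (*-distribˡ-sum (a j) (λ i → z i * u j i)))) ⟩
    a ∙ (λ j → z ∙ u j) ∎

  ∙-zero : ∀ (z : Vector Carrier n) {x} → (∀ i → x i ≈ 0#) → z ∙ x ≈ 0#
  ∙-zero z x≈0 = trans (∙-comm z _) (zero∙ x≈0 z)

  ⊥-linearCombination : ∀ (z : Vector Carrier n) a (u : Vector (Vector Carrier n) m) →
    (∀ j → z ∙ u j ≈ 0#) → z ∙ linearCombination a u ≈ 0#
  ⊥-linearCombination z a u z⊥u = trans (∙-linearCombination z a u) (∙-zero a z⊥u)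

  det-block : (M : Matrix Carrier (suc n) (suc n)) → (∀ j → M zero (suc j) ≈ 0#) →
    det M ≈ M zero zero * det (λ i j → M (suc i) (suc j))
  det-block M row = trans (+-cong (*-identityˡ _) (sum-zero λ j →
    trans (*-congˡ (trans (*-congʳ (row j)) (zeroˡ _))) (zeroʳ _))) (+-identityʳ _)

  𝟙-punchIn : ∀ (p : Fin (suc n)) i j → 𝟙 (punchIn p i) (punchIn p j) ≈ 𝟙 i j
  𝟙-punchIn p i j with i Fin.≟ j
  ... | yes ≡.refl = 𝟙-diagonal (punchIn p i)
  ... | no i≢j     = 𝟙-off-diagonal (i≢j ∘ Fin.punchIn-injective p i j)

  module _ (A : Matrix Carrier n n) (A-symmetric : ∀ i j → A i j ≈ A j i) where

    adjoint : ∀ x y → (A *ᵛ x) ∙ y ≈ x ∙ (A *ᵛ y)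
    adjoint x y = begin
      sum (λ i → sum (λ j → A i j * x j) * y i)
        ≈⟨ sum-cong-≋ (λ i → *-distribʳ-sum (y i) (λ j → A i j * x j)) ⟩
      sum (λ i → sum (λ j → A i j * x j * y i))
        ≈⟨ ∑-comm (λ i j → A i j * x j * y i) ⟩
      sum (λ j → sum (λ i → A i j * x j * y i))
        ≈⟨ sum-cong-≋ (λ j → trans
             (sum-cong-≋ (λ i → trans (*-congʳ (*-congʳ (A-symmetric i j)))
               (solve 3 (λ a x y → a :* x :* y := x :* (a :* y)) refl (A j i) (x j) (y i))))
             (sym (*-distribˡ-sum (x j) (λ i → A j i * y i)))) ⟩
      x ∙ (A *ᵛ y) ∎

    -- The symmetric bilinear form of xI - A.
    β : Carrier → Vector Carrier n → Vector Carrier n → Carrier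
    β x y z = x * y ∙ z - y ∙ (A *ᵛ z)

    β-comm : ∀ x y z → β x y z ≈ β x z y
    β-comm x y z = +-cong (*-congˡ (∙-comm y z)) (-‿cong (trans (sym (adjoint y z)) (∙-comm (A *ᵛ y) z)))

    β-linearCombinationˡ : ∀ x a (u : Vector (Vector Carrier n) m) z →
      β x (linearCombination a u) z ≈ a ∙ (λ j → β x (u j) z)
    β-linearCombinationˡ x a u z = begin
      x * lc ∙ z - lc ∙ (A *ᵛ z)
        ≈⟨ +-cong (*-congˡ (left z)) (-‿cong (left (A *ᵛ z))) ⟩
      x * a ∙ (λ j → u j ∙ z) - a ∙ (λ j → u j ∙ (A *ᵛ z))
        ≈⟨ solve 3 (λ x s b → x :* s :- b := x :* s :+ (:- con (ℤ.+ 1)) :* b) refl x _ _ ⟩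
      x * a ∙ (λ j → u j ∙ z) + - 1# * a ∙ (λ j → u j ∙ (A *ᵛ z))
        ≈⟨ ∙-linear₂ x (- 1#) a (λ j → u j ∙ z) (λ j → u j ∙ (A *ᵛ z)) ⟨
      a ∙ (λ j → x * u j ∙ z + - 1# * u j ∙ (A *ᵛ z))
        ≈⟨ ∙-cong {x = a} (λ _ → refl) (λ j → solve 3 (λ x s b → x :* s :+ (:- con (ℤ.+ 1)) :* b := x :* s :- b) refl x _ _) ⟩
      a ∙ (λ j → β x (u j) z) ∎
      where
      lc = linearCombination a u
      left : ∀ z → lc ∙ z ≈ a ∙ (λ j → u j ∙ z)
      left z = trans (∙-comm lc z) (trans (∙-linearCombination z a u) (∙-cong {x = a} (λ _ → refl) λ j → ∙-comm z (u j)))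

    β-linearCombinationʳ : ∀ x y a (u : Vector (Vector Carrier n) m) →
      β x y (linearCombination a u) ≈ a ∙ (λ j → β x y (u j))
    β-linearCombinationʳ x y a u = begin
      β x y (linearCombination a u)   ≈⟨ β-comm x y _ ⟩
      β x (linearCombination a u) y   ≈⟨ β-linearCombinationˡ x a u y ⟩
      a ∙ (λ j → β x (u j) y)         ≈⟨ ∙-cong {x = a} (λ _ → refl) (λ j → β-comm x (u j) y) ⟩
      a ∙ (λ j → β x y (u j))         ∎

    pencil : Vector (Vector Carrier n) m → Carrier → Matrix Carrier m m
    pencil u x i j = β x (u i) (u j)

    -- A change of family acts on the Gram matrix by congruence, so the determinant gains a factor
    -- independent of `x`.
    det-pencil-linearCombination : ∀ (T : Matrix Carrier m m) u x →
      det (pencil (λ i → linearCombination (T i) u) x) ≈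
      det (λ i j → T j i) * (det (pencil u x) * det T)
    det-pencil-linearCombination T u x = begin
      det (pencil (λ i → linearCombination (T i) u) x)
        ≈⟨ det-cong (λ i j → trans
             (β-linearCombinationʳ x (linearCombination (T i) u) (T j) u)
             (trans (∙-cong {x = T j} (λ _ → refl) λ l → β-linearCombinationˡ x (T i) u (u l))
                    (∙-comm (T j) (λ l → T i ∙ (λ k → β x (u k) (u l)))))) ⟩
      det ((T ⊗ pencil u x) ⊗ (λ i j → T j i))
        ≈⟨ trans (det-⊗ (T ⊗ pencil u x) (λ i j → T j i)) (*-congˡ (det-⊗ T (pencil u x))) ⟩
      det (λ i j → T j i) * (det (pencil u x) * det T) ∎

    -- The span of a family enters only through its orthogonal complement.
    record Eigenbasis (u : Vector (Vector Carrier n) m) (λs : Vector Carrier m) : Set (c ⊔ ℓ₁) where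
      field
        vectors    : Vector (Vector Carrier n) m
        eigen      : ∀ i l → (A *ᵛ vectors i) l ≈ λs i * vectors i l
        orthogonal : ∀ {i j} → i ≢ j → vectors i ∙ vectors j ≈ 0#
        nonzero    : ∀ i → vectors i ∙ vectors i ≉ 0#
        spans      : ∀ z → (∀ i → z ∙ vectors i ≈ 0#) → ∀ i → z ∙ u i ≈ 0#
        spanned    : ∀ z → (∀ i → z ∙ u i ≈ 0#) → ∀ i → z ∙ vectors i ≈ 0#

    -- The invariant of the deflation. The dual family witnesses linear independence, invariance of
    -- the span is stated for its orthogonal complement, and `scale` collects the determinants of
    -- the changes of family.
    record Deflatable (u : Vector (Vector Carrier n) m) (λs : Vector Carrier m) : Set (c ⊔ ℓ₁) where
      field
        dual      : Vector (Vector Carrier n) m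
        isDual    : ∀ i j → dual i ∙ u j ≈ 𝟙 j i
        invariant : ∀ x → (∀ i → x ∙ u i ≈ 0#) → ∀ i → (A *ᵛ x) ∙ u i ≈ 0#
        scale     : Carrier
        splits    : ∀ x → det (pencil u x) ≈ scale * product λ i → x - λs i

    -- One eigenvector v for λs zero is split off, and what remains of u is made
    -- orthogonal to v.
    module Deflation (u : Vector (Vector Carrier n) (suc m)) (λs : Vector Carrier (suc m))
                     (deflatable : Deflatable u λs) where
      open Deflatable deflatable

      λ₀ = λs zero

      singular : det (pencil u λ₀) ≈ 0#
      singular = trans (splits λ₀) (trans (*-congˡ (trans (*-congʳ (-‿inverseʳ λ₀)) (zeroˡ _))) (zeroʳ _))

      kernel = kernel-singular (pencil u λ₀) singular
      y = proj₁ kernel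
      p = proj₁ (proj₁ (proj₂ kernel))

      yₚ≉0 : y p ≉ 0#
      yₚ≉0 = proj₂ (proj₁ (proj₂ kernel))

      v : Vector Carrier n
      v = linearCombination y u

      ∙v : ∀ z → z ∙ v ≈ y ∙ (λ j → z ∙ u j)
      ∙v z = ∙-linearCombination z y u

      residual : Vector Carrier n
      residual l = λ₀ * v l + - 1# * (A *ᵛ v) l

      ∙-residual : ∀ z → z ∙ residual ≈ β λ₀ z v
      ∙-residual z = trans (∙-linear₂ λ₀ (- 1#) z v (A *ᵛ v))
        (solve 3 (λ x s b → x :* s :+ (:- con (ℤ.+ 1)) :* b := x :* s :- b) refl λ₀ _ _)

      residual⊥u : ∀ i → residual ∙ u i ≈ 0#
      residual⊥u i = begin
        residual ∙ u i               ≈⟨ ∙-comm residual (u i) ⟩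
        u i ∙ residual               ≈⟨ ∙-residual (u i) ⟩
        β λ₀ (u i) v                 ≈⟨ β-linearCombinationʳ λ₀ (u i) y u ⟩
        y ∙ pencil u λ₀ i            ≈⟨ ∙-comm y (pencil u λ₀ i) ⟩
        pencil u λ₀ i ∙ y            ≈⟨ proj₂ (proj₂ kernel) i ⟩
        0#                           ∎

      -- `residual` is orthogonal to the span, which contains `v`, and by invariance of the
      -- complement so is `A *ᵛ residual`. Moving `A` across the product shows that both parts
      -- vanish.
      residual∙residual : residual ∙ residual ≈ 0#
      residual∙residual = begin
        residual ∙ residual                           ≈⟨ ∙-residual residual ⟩
        λ₀ * residual ∙ v - residual ∙ (A *ᵛ v)
          ≈⟨ +-cong (*-congˡ (⊥-linearCombination residual y u residual⊥u))
                    (-‿cong (trans (sym (adjoint residual v))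
                      (⊥-linearCombination (A *ᵛ residual) y u (invariant residual residual⊥u)))) ⟩
        λ₀ * 0# - 0#                                  ≈⟨ trans (+-cong (zeroʳ _) -0#≈0#) (+-identityʳ _) ⟩
        0#                                            ∎

      v-eigen : ∀ l → (A *ᵛ v) l ≈ λ₀ * v l
      v-eigen l = begin
        (A *ᵛ v) l                  ≈⟨ solve 3 (λ x s b → b := x :* s :- (x :* s :+ (:- con (ℤ.+ 1)) :* b)) refl λ₀ (v l) _ ⟩
        λ₀ * v l - residual l       ≈⟨ +-congˡ (trans (-‿cong (∙-definite residual residual∙residual l)) -0#≈0#) ⟩
        λ₀ * v l + 0#               ≈⟨ +-identityʳ _ ⟩
        λ₀ * v l                    ∎

      Av∙ : ∀ z → (A *ᵛ v) ∙ z ≈ λ₀ * v ∙ z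
      Av∙ z = trans
        (sum-cong-≋ λ l → trans (*-congʳ (v-eigen l)) (*-assoc λ₀ (v l) (z l)))
        (sym (*-distribˡ-sum λ₀ (λ l → v l * z l)))

      dual∙v : ∀ i → dual i ∙ v ≈ y i
      dual∙v i = trans (∙v (dual i)) (trans (∙-cong {x = y} (λ _ → refl) (isDual i)) (∙-𝟙 y i))

      σ = v ∙ v

      -- `dual p` reads the nonzero coefficient `y p` off `v`, so `v` is not zero and definiteness
      -- applies.
      σ≉0 : σ ≉ 0#
      σ≉0 σ≈0 = yₚ≉0 (trans (sym (dual∙v p)) (∙-zero (dual p) (∙-definite v σ≈0)))

      σ⁻¹ = proj₁ (inverse σ σ≉0)
      σσ⁻¹≈1 = proj₂ (inverse σ σ≉0)

      projection : Vector Carrier m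
      projection j = u (punchIn p j) ∙ v * σ⁻¹

      -- Exchange and Gram-Schmidt in one matrix: `v` takes the place of `u p`, in which it has the
      -- nonzero coefficient `y p`, and the other members lose their component along `v`.
      T : Matrix Carrier (suc m) (suc m)
      T zero      = y
      T (suc j) l = 𝟙 l (punchIn p j) + - projection j * y l

      u′ : Vector (Vector Carrier n) m
      u′ j = linearCombination (T (suc j)) u

      ∙u′ : ∀ z j → z ∙ u′ j ≈ z ∙ u (punchIn p j) + - projection j * z ∙ v
      ∙u′ z j = begin
        z ∙ u′ j                                 ≈⟨ ∙-linearCombination z (T (suc j)) u ⟩
        T (suc j) ∙ (λ l → z ∙ u l)              ≈⟨ ∙-comm (T (suc j)) (λ l → z ∙ u l) ⟩
        (λ l → z ∙ u l) ∙ T (suc j)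
          ≈⟨ ∙-linearʳ (λ l → z ∙ u l) (λ l → 𝟙 l (punchIn p j)) y (- projection j) ⟩
        (λ l → z ∙ u l) ∙ (λ l → 𝟙 l (punchIn p j)) + - projection j * (λ l → z ∙ u l) ∙ y
          ≈⟨ +-cong (∙-𝟙 (λ l → z ∙ u l) (punchIn p j))
               (*-congˡ (trans (∙-comm (λ l → z ∙ u l) y) (sym (∙v z)))) ⟩
        z ∙ u (punchIn p j) + - projection j * z ∙ v ∎

      v∙u′ : ∀ j → v ∙ u′ j ≈ 0#
      v∙u′ j = begin
        v ∙ u′ j                                         ≈⟨ ∙u′ v j ⟩
        v ∙ u (punchIn p j) + - projection j * σ         ≈⟨ +-congʳ (∙-comm v (u (punchIn p j))) ⟩
        s + - (s * σ⁻¹) * σ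
          ≈⟨ solve 3 (λ s τ σ → s :+ :- (s :* τ) :* σ := s :* (con (ℤ.+ 1) :- σ :* τ)) refl s σ⁻¹ σ ⟩
        s * (1# - σ * σ⁻¹)                               ≈⟨ *-congˡ (trans (+-congˡ (-‿cong σσ⁻¹≈1)) (-‿inverseʳ 1#)) ⟩
        s * 0#                                           ≈⟨ zeroʳ s ⟩
        0#                                               ∎
        where s = u (punchIn p j) ∙ v

      -- Away from `p`, `u` and `u′` differ by multiples of `v`. Then `z ∙ v` reduces to
      -- `y p * z ∙ u p`, and `y p` cancels.
      ⊥u : ∀ z → z ∙ v ≈ 0# → (∀ j → z ∙ u′ j ≈ 0#) → ∀ i → z ∙ u i ≈ 0#
      ⊥u z z⊥v z⊥u′ = λ i → case i (i Fin.≟ p)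
        where
        others : ∀ j → z ∙ u (punchIn p j) ≈ 0#
        others j = begin
          z ∙ u (punchIn p j)                            ≈⟨ trans (+-congˡ (trans (*-congˡ z⊥v) (zeroʳ _))) (+-identityʳ _) ⟨
          z ∙ u (punchIn p j) + - projection j * z ∙ v   ≈⟨ ∙u′ z j ⟨
          z ∙ u′ j                                       ≈⟨ z⊥u′ j ⟩
          0#                                             ∎
        other : ∀ {i} → i ≢ p → z ∙ u i ≈ 0#
        other i≢p = trans (reflexive (≡.cong (λ i → z ∙ u i) (≡.sym (Fin.punchIn-punchOut (i≢p ∘ ≡.sym))))) (others _)
        case : ∀ i → Dec (i ≡ p) → z ∙ u i ≈ 0#
        case i (no i≢p)     = other i≢p
        case i (yes ≡.refl) = *-cancel-zero yₚ≉0 (trans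
          (sym (sum-single p (λ j → y j * z ∙ u j) λ j j≢p → trans (*-congˡ (other j≢p)) (zeroʳ _)))
          (trans (sym (∙v z)) z⊥v))

      -- Such an `x` may have a component along `v`. Without it, `x′` is orthogonal to all of `u`
      -- and the old invariance applies; the removed component stays a multiple of `v` under `A`,
      -- hence orthogonal to `u′`.
      invariant′ : ∀ x → (∀ i → x ∙ u′ i ≈ 0#) → ∀ i → (A *ᵛ x) ∙ u′ i ≈ 0#
      invariant′ x x⊥u′ i = begin
        (A *ᵛ x) ∙ t                             ≈⟨ adjoint x t ⟩
        x ∙ (A *ᵛ t)
          ≈⟨ solve 3 (λ a s b → a := a :+ :- s :* b :+ s :* b) refl (x ∙ (A *ᵛ t)) s (v ∙ (A *ᵛ t)) ⟩
        x ∙ (A *ᵛ t) + - s * v ∙ (A *ᵛ t) + s * v ∙ (A *ᵛ t)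
          ≈⟨ +-cong (sym (x′∙ (A *ᵛ t))) (*-congˡ (trans (sym (adjoint v t)) (trans (Av∙ t) (*-congˡ (v∙u′ i))))) ⟩
        x′ ∙ (A *ᵛ t) + s * (λ₀ * 0#)
          ≈⟨ +-cong (trans (sym (adjoint x′ t))
                      (⊥-linearCombination (A *ᵛ x′) (T (suc i)) u (invariant x′ (⊥u x′ x′⊥v x′⊥u′))))
                    (trans (*-congˡ (zeroʳ _)) (zeroʳ _)) ⟩
        0# + 0#                                  ≈⟨ +-identityʳ 0# ⟩
        0#                                       ∎
        where
        t = u′ i
        s = x ∙ v * σ⁻¹
        x′ : Vector Carrier n
        x′ l = x l + - s * v l
        x′∙ : ∀ z → x′ ∙ z ≈ x ∙ z + - s * v ∙ z
        x′∙ z = trans (∙-comm x′ z) (trans (∙-linearʳ z x v (- s)) (+-cong (∙-comm z x) (*-congˡ (∙-comm z v))))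
        x′⊥v : x′ ∙ v ≈ 0#
        x′⊥v = begin
          x′ ∙ v                       ≈⟨ x′∙ v ⟩
          x ∙ v + - (x ∙ v * σ⁻¹) * σ
            ≈⟨ solve 3 (λ s τ σ → s :+ :- (s :* τ) :* σ := s :* (con (ℤ.+ 1) :- σ :* τ)) refl (x ∙ v) σ⁻¹ σ ⟩
          x ∙ v * (1# - σ * σ⁻¹)       ≈⟨ *-congˡ (trans (+-congˡ (-‿cong σσ⁻¹≈1)) (-‿inverseʳ 1#)) ⟩
          x ∙ v * 0#                   ≈⟨ zeroʳ _ ⟩
          0#                           ∎
        x′⊥u′ : ∀ j → x′ ∙ u′ j ≈ 0#
        x′⊥u′ j = trans (x′∙ (u′ j)) (trans
          (+-cong (x⊥u′ j) (trans (*-congˡ (v∙u′ j)) (zeroʳ _))) (+-identityʳ 0#))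

      yₚ⁻¹ = proj₁ (inverse (y p) yₚ≉0)

      -- The multiple of `dual p` is chosen to annihilate `v`, and so the projection term in `u′`;
      -- on the members other than `u p` it changes nothing.
      dual′ : Vector (Vector Carrier n) m
      dual′ j l = dual (punchIn p j) l + - (y (punchIn p j) * yₚ⁻¹) * dual p l

      dual′∙ : ∀ j z → dual′ j ∙ z ≈ dual (punchIn p j) ∙ z + - (y (punchIn p j) * yₚ⁻¹) * dual p ∙ z
      dual′∙ j z = trans (∙-comm (dual′ j) z) (trans (∙-linearʳ z (dual (punchIn p j)) (dual p) _)
        (+-cong (∙-comm z _) (*-congˡ (∙-comm z _))))

      dual′∙v : ∀ j → dual′ j ∙ v ≈ 0#
      dual′∙v j = begin
        dual′ j ∙ v                    ≈⟨ trans (dual′∙ j v) (+-cong (dual∙v (punchIn p j)) (*-congˡ (dual∙v p))) ⟩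
        s + - (s * yₚ⁻¹) * y p
          ≈⟨ solve 3 (λ s τ σ → s :+ :- (s :* τ) :* σ := s :* (con (ℤ.+ 1) :- σ :* τ)) refl s yₚ⁻¹ (y p) ⟩
        s * (1# - y p * yₚ⁻¹)
          ≈⟨ *-congˡ (trans (+-congˡ (-‿cong (proj₂ (inverse (y p) yₚ≉0)))) (-‿inverseʳ 1#)) ⟩
        s * 0#                         ≈⟨ zeroʳ s ⟩
        0#                             ∎
        where s = y (punchIn p j)

      isDual′ : ∀ i j → dual′ i ∙ u′ j ≈ 𝟙 j i
      isDual′ i j = begin
        dual′ i ∙ u′ j
          ≈⟨ trans (∙u′ (dual′ i) j) (trans (+-congˡ (trans (*-congˡ (dual′∙v i)) (zeroʳ _))) (+-identityʳ _)) ⟩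
        dual′ i ∙ u (punchIn p j)
          ≈⟨ dual′∙ i (u (punchIn p j)) ⟩
        dual (punchIn p i) ∙ u (punchIn p j) + - (y (punchIn p i) * yₚ⁻¹) * dual p ∙ u (punchIn p j)
          ≈⟨ +-cong (trans (isDual _ _) (𝟙-punchIn p j i))
                    (*-congˡ (trans (isDual p _) (𝟙-off-diagonal (Fin.punchInᵢ≢i p j)))) ⟩
        𝟙 j i + - (y (punchIn p i) * yₚ⁻¹) * 0#
          ≈⟨ trans (+-congˡ (zeroʳ _)) (+-identityʳ _) ⟩
        𝟙 j i ∎

      κ = det (λ i j → T j i) * (scale * det T)

      u″ : Vector (Vector Carrier n) (suc m)
      u″ i = linearCombination (T i) u

      -- As `v` is an eigenvector orthogonal to `u′`, the pencil of `u″` is block diagonal with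
      -- corner `(x - λ₀) * σ`. The constant `κ` is the old scale times the factor from the
      -- congruence by `T`.
      det-deflate : ∀ x → (x - λ₀) * (σ * det (pencil u′ x)) ≈ (x - λ₀) * (κ * product λ i → x - λs (suc i))
      det-deflate x = begin
        (x - λ₀) * (σ * det (pencil u′ x))
          ≈⟨ solve 4 (λ x l s d → (x :- l) :* (s :* d) := (x :* s :- l :* s) :* d) refl x λ₀ σ _ ⟩
        (x * σ - λ₀ * σ) * det (pencil u′ x)
          ≈⟨ *-congʳ (+-congˡ (-‿cong (trans (sym (Av∙ v)) (∙-comm (A *ᵛ v) v)))) ⟩
        pencil u″ x zero zero * det (pencil u′ x)
          ≈⟨ det-block (pencil u″ x) (λ j → corner j) ⟨
        det (pencil u″ x)
          ≈⟨ det-pencil-linearCombination T u x ⟩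
        det (λ i j → T j i) * (det (pencil u x) * det T)
          ≈⟨ *-congˡ (*-congʳ (splits x)) ⟩
        det (λ i j → T j i) * ((scale * ((x - λ₀) * product λ i → x - λs (suc i))) * det T)
          ≈⟨ solve 5 (λ t s x π d → t :* ((s :* (x :* π)) :* d) := x :* ((t :* (s :* d)) :* π)) refl _ scale _ _ (det T) ⟩
        (x - λ₀) * (κ * product λ i → x - λs (suc i)) ∎
        where
        corner : ∀ j → β x v (u′ j) ≈ 0#
        corner j = begin
          x * v ∙ u′ j - v ∙ (A *ᵛ u′ j)
            ≈⟨ +-cong (*-congˡ (v∙u′ j)) (-‿cong (trans (sym (adjoint v (u′ j))) (trans (Av∙ (u′ j)) (*-congˡ (v∙u′ j))))) ⟩
          x * 0# - λ₀ * 0#   ≈⟨ solve 2 (λ x l → x :* con (ℤ.+ 0) :- l :* con (ℤ.+ 0) := con (ℤ.+ 0)) refl x λ₀ ⟩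
          0#                 ∎

      splits′ : ∀ x → det (pencil u′ x) ≈ (σ⁻¹ * κ) * product λ i → x - λs (suc i)
      splits′ x = begin
        det (pencil u′ x)
          ≈⟨ trans (*-congʳ σσ⁻¹≈1) (*-identityˡ _) ⟨
        (σ * σ⁻¹) * det (pencil u′ x)
          ≈⟨ solve 5 (λ s τ k d π → (s :* τ) :* d := τ :* (s :* d :+ :- k :* π) :+ (τ :* k) :* π)
               refl σ σ⁻¹ κ _ _ ⟩
        σ⁻¹ * (σ * det (pencil u′ x) + - κ * product (λ i → x - λs (suc i))) + (σ⁻¹ * κ) * product (λ i → x - λs (suc i))
          ≈⟨ +-congʳ (trans (*-congˡ (difference x)) (zeroʳ _)) ⟩
        0# + (σ⁻¹ * κ) * product (λ i → x - λs (suc i))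
          ≈⟨ +-identityˡ _ ⟩
        (σ⁻¹ * κ) * product (λ i → x - λs (suc i)) ∎
        where
        difference : ∀ x → σ * det (pencil u′ x) + - κ * product (λ i → x - λs (suc i)) ≈ 0#
        difference = polynomial-cancel
          (polynomial-combine σ (- κ)
            (polynomial-det (λ i j → u′ i ∙ u′ j) (λ i j → u′ i ∙ (A *ᵛ u′ j)))
            (polynomial-product (tail λs)))
          λ₀ λ x → trans
            (solve 5 (λ x s k d π → x :* (s :* d :+ :- k :* π) := x :* (s :* d) :- x :* (k :* π)) refl _ σ κ _ _)
            (trans (+-congʳ (det-deflate x)) (-‿inverseʳ _))

      deflatable′ : Deflatable u′ (tail λs)
      deflatable′ = record
        { dual = dual′ ; isDual = isDual′ ; invariant = invariant′ ; scale = σ⁻¹ * κ ; splits = splits′ }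

      extend : Eigenbasis u′ (tail λs) → Eigenbasis u λs
      extend basis = record
        { vectors    = vs
        ; eigen      = λ { zero → v-eigen ; (suc i) → B.eigen i }
        ; orthogonal = orthogonal
        ; nonzero    = λ { zero → σ≉0 ; (suc i) → B.nonzero i }
        ; spans      = λ z z⊥vs → ⊥u z (z⊥vs zero) (B.spans z (z⊥vs ∘ suc))
        ; spanned    = λ { z z⊥u zero    → ⊥-linearCombination z y u z⊥u
                         ; z z⊥u (suc i) → B.spanned z (λ j → ⊥-linearCombination z (T (suc j)) u z⊥u) i }
        }
        where
        module B = Eigenbasis basis
        vs = v Vector.∷ B.vectors
        orthogonal : ∀ {i j} → i ≢ j → vs i ∙ vs j ≈ 0#
        orthogonal {zero}  {zero}  i≢j = contradiction ≡.refl i≢j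
        orthogonal {zero}  {suc j} _   = B.spanned v v∙u′ j
        orthogonal {suc i} {zero}  _   = trans (∙-comm (B.vectors i) v) (B.spanned v v∙u′ i)
        orthogonal {suc i} {suc j} i≢j = B.orthogonal (i≢j ∘ ≡.cong suc)

    diagonalise : (u : Vector (Vector Carrier n) m) (λs : Vector Carrier m) → Deflatable u λs → Eigenbasis u λs
    diagonalise {zero} u λs _ = record
      { vectors = λ () ; eigen = λ () ; orthogonal = λ { {()} } ; nonzero = λ () ; spans = λ _ _ () ; spanned = λ _ _ () }
    diagonalise {suc m} u λs deflatable = extend (diagonalise u′ (tail λs) deflatable′)
      where open Deflation u λs deflatable

    eigenbasis : (λs : Vector Carrier n) → IsSpectrum A λs → Eigenbasis (λ i l → 𝟙 l i) λs
    eigenbasis λs spectrum = diagonalise e λs (record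
      { dual      = e
      ; isDual    = λ i j → ∙-𝟙 (e i) j
      -- The orthogonal complement of the standard basis is zero.
      ; invariant = λ x x⊥e i → trans (∙-𝟙 (A *ᵛ x) i) (∙-zero (A i) λ j → trans (sym (∙-𝟙 x j)) (x⊥e j))
      ; scale     = 1#
      ; splits    = λ x → begin
          det (pencil e x)             ≈⟨ det-cong (λ i j → +-cong
                                            (*-congˡ (trans (∙-comm (e i) (e j)) (∙-𝟙 (e j) i)))
                                            (-‿cong (entry i j))) ⟩
          charPoly A x                 ≈⟨ splits x ⟩
          product (λ i → x - λs i)     ≈⟨ *-identityˡ _ ⟨
          1# * product (λ i → x - λs i) ∎
      })
      where
      open IsSpectrum spectrum
      e : Vector (Vector Carrier n) n
      e i l = 𝟙 l i
      entry : ∀ i j → e i ∙ (A *ᵛ e j) ≈ A i j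
      entry i j = trans (∙-comm (e i) (A *ᵛ e j)) (trans (∙-𝟙 (A *ᵛ e j) i) (∙-𝟙 (A i) j))

-- Counted sets as indexed families.

-- Makes a count the index type of a family, which can then serve as rows of a linear system;
-- covering is what guarantees that no condition is missed.
enumerate : ∀ {a p} {A : Set a} {P : Pred A p} (P? : Decidable P) {n} (xs : Vec A n) →
  ∃ λ (f : Fin (Vec.count P? xs) → A) → ∀ {x} → x Vec.∈ xs → P x → ∃ λ j → f j ≡ x
enumerate P? [] = (λ ()) , λ ()
enumerate P? (x ∷ xs) with P? x | enumerate P? xs
... | yes Px | f , covers = (x Vector.∷ f) , λ
  { (here ≡.refl) _ → zero , ≡.refl
  ; (there x∈xs) Px → let j , eq = covers x∈xs Px in suc j , eq }
... | no ¬Px | f , covers = f , λ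
  { (here ≡.refl) Px → contradiction Px ¬Px
  ; (there x∈xs) Px → covers x∈xs Px }

enumerateSubset : ∀ {n} (U : Subset n) → ∃ λ (f : Fin ∣ U ∣ → Fin n) → ∀ {x} → x ∈ U → ∃ λ j → f j ≡ x
enumerateSubset [] = (λ ()) , λ ()
enumerateSubset (inside ∷ U) = let f , covers = enumerateSubset U in (zero Vector.∷ (suc ∘ f)) , λ
  { here        → zero , ≡.refl
  ; (there x∈U) → let j , eq = covers x∈U in suc j , ≡.cong suc eq }
enumerateSubset (outside ∷ U) = let f , covers = enumerateSubset U in (suc ∘ f) , λ
  { (there x∈U) → let j , eq = covers x∈U in j , ≡.cong suc eq }

-- Comparing the form on a coordinate subspace with the eigenvalues.

module Inertia {c ℓ₁ ℓ₂} (F : OrderedField c ℓ₁ ℓ₂) {n} (A : Matrix (OrderedField.Carrier F) n n)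
               (A-symmetric : ∀ i j → OrderedField._≈_ F (A i j) (A j i))
               (λs : Vector (OrderedField.Carrier F) n) (spectrum : Spectrum.IsSpectrum F A λs) where
  open OrderedField F hiding (zero)
  open SemiringSum semiring using (sum; sum-cong-≋)
  open SemiringMatrix semiring using (𝟙; _⊗_; _^ᴹ_)
  open LinearAlgebra F
  open Order F
  open Diagonalisation F
  open Spectrum F using (_^_)
  open ℤSolver commutativeRing using (solve; _:=_; _:+_; _:*_; _:-_; :-_; con)
  open SetoidReasoning setoid
  open Eigenbasis (eigenbasis A A-symmetric λs spectrum)

  total-vectors : ∀ x → (∀ i → x ∙ vectors i ≈ 0#) → ∀ i → x i ≈ 0#
  total-vectors x x⊥v i = trans (sym (∙-𝟙 x i)) (spans x x⊥v i)

  σ τ : Vector Carrier n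
  σ i = vectors i ∙ vectors i
  τ i = proj₁ (inverse (σ i) (nonzero i))

  στ≈1 : ∀ i → σ i * τ i ≈ 1#
  στ≈1 i = proj₂ (inverse (σ i) (nonzero i))

  τ≉0 : ∀ i → τ i ≉ 0#
  τ≉0 i τ≈0 = 0≉1 (trans (sym (trans (*-congˡ τ≈0) (zeroʳ _))) (στ≈1 i))

  -- `τ i` equals `σ i * (τ i * τ i)`, a sum of squares times a square.
  τ-nonneg : ∀ i → 0# ≤ τ i
  τ-nonneg i = ≤-resp refl
    (trans (sym (*-assoc (σ i) (τ i) (τ i))) (trans (*-congʳ (στ≈1 i)) (*-identityˡ _)))
    (*-nonneg (sum-nonneg _ λ l → square-nonneg (vectors i l)) (square-nonneg (τ i)))

  coordinate : Vector Carrier n → Vector Carrier n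
  coordinate x i = τ i * x ∙ vectors i

  -- `x` minus its expansion is orthogonal to every eigenvector, hence zero. The factor `τ i` in
  -- `coordinate` stands in for normalisation.
  parseval : ∀ x z → x ∙ z ≈ coordinate x ∙ (λ i → z ∙ vectors i)
  parseval x z = begin
    x ∙ z
      ≈⟨ ∙-comm x z ⟩
    z ∙ x
      ≈⟨ solve 2 (λ a b → a := (a :+ (:- con (ℤ.+ 1)) :* b) :+ b) refl (z ∙ x) (z ∙ expansion) ⟩
    z ∙ x + - 1# * z ∙ expansion + z ∙ expansion
      ≈⟨ +-cong (trans (sym (∙-linearʳ z x expansion (- 1#))) (∙-zero z remainder≈0)) (∙-linearCombination z (coordinate x) vectors) ⟩
    0# + coordinate x ∙ (λ i → z ∙ vectors i)
      ≈⟨ +-identityˡ _ ⟩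
    coordinate x ∙ (λ i → z ∙ vectors i) ∎
    where
    expansion = linearCombination (coordinate x) vectors
    remainder : Vector Carrier n
    remainder l = x l + - 1# * expansion l
    vectors∙expansion : ∀ i → vectors i ∙ expansion ≈ x ∙ vectors i
    vectors∙expansion i = begin
      vectors i ∙ expansion
        ≈⟨ ∙-linearCombination (vectors i) (coordinate x) vectors ⟩
      coordinate x ∙ (λ j → vectors i ∙ vectors j)
        ≈⟨ sum-single i (λ j → coordinate x j * vectors i ∙ vectors j)
             (λ j j≢i → trans (*-congˡ (orthogonal (j≢i ∘ ≡.sym))) (zeroʳ _)) ⟩
      τ i * x ∙ vectors i * σ i
        ≈⟨ solve 3 (λ t x s → t :* x :* s := (s :* t) :* x) refl (τ i) _ (σ i) ⟩
      σ i * τ i * x ∙ vectors i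
        ≈⟨ trans (*-congʳ (στ≈1 i)) (*-identityˡ _) ⟩
      x ∙ vectors i ∎
    remainder≈0 : ∀ l → remainder l ≈ 0#
    remainder≈0 = total-vectors remainder λ i → begin
      remainder ∙ vectors i                                   ≈⟨ ∙-comm remainder (vectors i) ⟩
      vectors i ∙ remainder                                   ≈⟨ ∙-linearʳ (vectors i) x expansion (- 1#) ⟩
      vectors i ∙ x + - 1# * vectors i ∙ expansion            ≈⟨ +-cong (∙-comm (vectors i) x) (*-congˡ (vectors∙expansion i)) ⟩
      x ∙ vectors i + - 1# * x ∙ vectors i
        ≈⟨ solve 1 (λ a → a :+ (:- con (ℤ.+ 1)) :* a := con (ℤ.+ 0)) refl (x ∙ vectors i) ⟩
      0#                                                      ∎

  ⊗-*ᵛ : ∀ (M N : Matrix Carrier n n) x l → ((M ⊗ N) *ᵛ x) l ≈ (M *ᵛ N *ᵛ x) l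
  ⊗-*ᵛ M N x l = begin
    (λ j → M l ∙ (λ i → N i j)) ∙ x          ≈⟨ ∙-comm (λ j → M l ∙ (λ i → N i j)) x ⟩
    x ∙ (λ j → M l ∙ (λ i → N i j))          ≈⟨ ∙-linearCombination (M l) x (λ j i → N i j) ⟨
    M l ∙ (λ i → x ∙ N i)                    ≈⟨ ∙-cong {x = M l} (λ _ → refl) (λ i → ∙-comm x (N i)) ⟩
    M l ∙ (N *ᵛ x)                           ∎

  power∙vectors : ∀ k x i → (A ^ᴹ k *ᵛ x) ∙ vectors i ≈ λs i ^ k * x ∙ vectors i
  power∙vectors zero x i = trans
    (∙-cong {y = vectors i} (λ l → trans
      (sum-single l (λ j → 𝟙 l j * x j) λ j j≢l → trans (*-congʳ (𝟙-off-diagonal (j≢l ∘ ≡.sym))) (zeroˡ _))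
      (trans (*-congʳ (𝟙-diagonal l)) (*-identityˡ _))) (λ _ → refl))
    (sym (*-identityˡ _))
  power∙vectors (suc k) x i = begin
    ((A ⊗ A ^ᴹ k) *ᵛ x) ∙ vectors i          ≈⟨ ∙-cong {y = vectors i} (⊗-*ᵛ A (A ^ᴹ k) x) (λ _ → refl) ⟩
    (A *ᵛ A ^ᴹ k *ᵛ x) ∙ vectors i           ≈⟨ adjoint A A-symmetric (A ^ᴹ k *ᵛ x) (vectors i) ⟩
    (A ^ᴹ k *ᵛ x) ∙ (A *ᵛ vectors i)         ≈⟨ ∙-cong {x = A ^ᴹ k *ᵛ x} (λ _ → refl) (λ l →
                                                  trans (eigen i l) (sym (+-identityˡ _))) ⟩
    (A ^ᴹ k *ᵛ x) ∙ (λ l → 0# + λs i * vectors i l) ≈⟨ ∙-linearʳ (A ^ᴹ k *ᵛ x) (λ _ → 0#) (vectors i) (λs i) ⟩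
    (A ^ᴹ k *ᵛ x) ∙ (λ _ → 0#) + λs i * (A ^ᴹ k *ᵛ x) ∙ vectors i
      ≈⟨ +-cong (∙-zero (A ^ᴹ k *ᵛ x) (λ _ → refl)) (*-congˡ (power∙vectors k x i)) ⟩
    0# + λs i * (λs i ^ k * x ∙ vectors i)   ≈⟨ +-identityˡ _ ⟩
    λs i * (λs i ^ k * x ∙ vectors i)        ≈⟨ *-assoc (λs i) (λs i ^ k) _ ⟨
    λs i ^ suc k * x ∙ vectors i             ∎

  -- On vectors supported in U the form s (Aᵏ - θ) is diagonal with nonnegative
  -- entries; in the eigenbasis it is negative off the eigenvectors satisfying P.
  -- A nonzero vector supported in U and orthogonal to the latter is impossible.
  inertia : ∀ {p} {P : Pred (Fin n) p} (P? : Decidable P) (k : ℕ) (s θ : Carrier) (U : Subset n) →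
    (∀ i → ¬ P i → 0# ≤ s * (θ - λs i ^ k) × s * (θ - λs i ^ k) ≉ 0#) →
    (∀ u → 0# ≤ s * ((A ^ᴹ k) u u - θ)) →
    (∀ {u v} → u ∈ U → v ∈ U → u ≢ v → (A ^ᴹ k) u v ≈ 0#) →
    ∣ U ∣ ℕ.≤ #[ P? ]
  inertia {P = P} P? k s θ U negative diagonal offDiagonal = ℕ.≮⇒≥ impossible
    where
    B = A ^ᴹ k

    impossible : ¬ (#[ P? ] ℕ.< ∣ U ∣)
    impossible few = proj₂ (proj₁ (proj₂ kernel)) (total-vectors x x⊥vectors _)
      where
      good = enumerate P? (Vec.allFin n)
      outsideU = enumerateSubset (∁ U)

      -- The first block asks for orthogonality to the eigenvectors satisfying `P`, the second for
      -- vanishing outside `U`.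
      constraints : Matrix Carrier (#[ P? ] ℕ.+ ∣ ∁ U ∣) n
      constraints = (vectors ∘ proj₁ good) Vector.++ (λ j l → 𝟙 l (proj₁ outsideU j))

      fewer : #[ P? ] ℕ.+ ∣ ∁ U ∣ ℕ.< n
      fewer = ≡.subst₂ ℕ._<_ (≡.cong (#[ P? ] ℕ.+_) (≡.sym (∣∁p∣≡n∸∣p∣ U))) (ℕ.m+[n∸m]≡n (∣p∣≤n U))
        (ℕ.+-monoˡ-< (n ℕ.∸ ∣ U ∣) few)

      kernel = kernel-underdetermined fewer constraints
      x = proj₁ kernel

      x⊥constraints : ∀ i → x ∙ constraints i ≈ 0#
      x⊥constraints i = trans (∙-comm x (constraints i)) (proj₂ (proj₂ kernel) i)

      x⊥good : ∀ {i} → P i → x ∙ vectors i ≈ 0#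
      x⊥good {i} Pi with proj₂ good (∈-allFin⁺ i) Pi
      ... | j , ≡.refl = trans
        (reflexive (≡.cong (x ∙_) (≡.sym (Vector.lookup-++ˡ (vectors ∘ proj₁ good) _ j)))) (x⊥constraints (j Fin.↑ˡ _))

      supported : ∀ {u} → u ∉ U → x u ≈ 0#
      supported {u} u∉U with proj₂ outsideU (x∉p⇒x∈∁p u∉U)
      ... | j , ≡.refl = trans (sym (∙-𝟙 x _)) (trans
        (reflexive (≡.cong (x ∙_) (≡.sym (Vector.lookup-++ʳ (vectors ∘ proj₁ good) (λ j l → 𝟙 l (proj₁ outsideU j)) j))))
        (x⊥constraints (#[ P? ] Fin.↑ʳ j)))

      vertexTerm eigenTerm : Vector Carrier n
      vertexTerm u = s * (B u u - θ) * (x u * x u)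
      eigenTerm i  = s * (θ - λs i ^ k) * (τ i * (x ∙ vectors i * x ∙ vectors i))

      -- For `u` in `U` an off-diagonal term vanishes through `B` if its index lies in `U` and
      -- through `x` otherwise; for `u` outside `U` both sides are zero.
      x*Bx : ∀ u → x u * (B *ᵛ x) u ≈ B u u * (x u * x u)
      x*Bx u with u ∈? U
      ... | no u∉U = trans (*-congʳ (supported u∉U)) (trans (zeroˡ _) (sym
        (trans (*-congˡ (trans (*-congʳ (supported u∉U)) (zeroˡ _))) (zeroʳ _))))
      ... | yes u∈U = trans
        (*-congˡ (sum-single u (λ l → B u l * x l) other))
        (solve 2 (λ x b → x :* (b :* x) := b :* (x :* x)) refl (x u) (B u u))
        where
        other : ∀ l → l ≢ u → B u l * x l ≈ 0#
        other l l≢u with l ∈? U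
        ... | yes l∈U = trans (*-congʳ (offDiagonal u∈U l∈U (l≢u ∘ ≡.sym))) (zeroˡ _)
        ... | no l∉U  = trans (*-congˡ (supported l∉U)) (zeroʳ _)

      vertexSum : sum vertexTerm ≈ s * x ∙ (B *ᵛ x) + - (s * θ) * x ∙ x
      vertexSum = begin
        sum vertexTerm
          ≈⟨ sum-cong-≋ (λ u → trans
               (solve 4 (λ s b t x → s :* (b :- t) :* (x :* x) := s :* (b :* (x :* x)) :+ :- (s :* t) :* (x :* x))
                 refl s (B u u) θ (x u))
               (trans (+-congʳ (*-congˡ (sym (x*Bx u))))
                 (solve 5 (λ s b t x y → s :* (x :* y) :+ :- (s :* t) :* (x :* x) := x :* (s :* y :+ :- (s :* t) :* x))
                   refl s (B u u) θ (x u) ((B *ᵛ x) u)))) ⟩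
        x ∙ (λ u → s * (B *ᵛ x) u + - (s * θ) * x u)
          ≈⟨ ∙-linear₂ s (- (s * θ)) x (B *ᵛ x) x ⟩
        s * x ∙ (B *ᵛ x) + - (s * θ) * x ∙ x ∎

      eigenSum : sum eigenTerm ≈ s * θ * x ∙ x + - s * x ∙ (B *ᵛ x)
      eigenSum = begin
        sum eigenTerm
          ≈⟨ sum-cong-≋ (λ i → solve 5 (λ s t l τ x → s :* (t :- l) :* (τ :* (x :* x))
               := (τ :* x) :* (s :* t :* x :+ :- s :* (l :* x))) refl s θ (λs i ^ k) (τ i) (x ∙ vectors i)) ⟩
        coordinate x ∙ (λ i → s * θ * x ∙ vectors i + - s * (λs i ^ k * x ∙ vectors i))
          ≈⟨ ∙-linear₂ (s * θ) (- s) (coordinate x) (λ i → x ∙ vectors i) (λ i → λs i ^ k * x ∙ vectors i) ⟩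
        s * θ * coordinate x ∙ (λ i → x ∙ vectors i) + - s * coordinate x ∙ (λ i → λs i ^ k * x ∙ vectors i)
          ≈⟨ +-cong (*-congˡ (sym (parseval x x))) (*-congˡ (trans
               (∙-cong {x = coordinate x} (λ _ → refl) (λ i → sym (power∙vectors k x i)))
               (sym (parseval x (B *ᵛ x))))) ⟩
        s * θ * x ∙ x + - s * x ∙ (B *ᵛ x) ∎

      -- The same form evaluated at `x` in two bases and with opposite signs. As both sums are
      -- nonnegative, every term has to vanish.
      balance : sum vertexTerm + sum eigenTerm ≈ 0#
      balance = trans (+-cong vertexSum eigenSum)
        (solve 4 (λ s t b y → (s :* b :+ :- (s :* t) :* y) :+ (s :* t :* y :+ :- s :* b) := con (ℤ.+ 0))
          refl s θ (x ∙ (B *ᵛ x)) (x ∙ x))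

      vertexTerm-nonneg : ∀ u → 0# ≤ vertexTerm u
      vertexTerm-nonneg u = *-nonneg (diagonal u) (square-nonneg (x u))

      eigenTerm-nonneg : ∀ i → 0# ≤ eigenTerm i
      eigenTerm-nonneg i with P? i
      ... | yes Pi = ≤-reflexive (sym (trans
        (*-congˡ (trans (*-congˡ (trans (*-congʳ (x⊥good Pi)) (zeroˡ _))) (zeroʳ _))) (zeroʳ _)))
      ... | no ¬Pi = *-nonneg (proj₁ (negative i ¬Pi)) (*-nonneg (τ-nonneg i) (square-nonneg (x ∙ vectors i)))

      eigenTerm≈0 : ∀ i → eigenTerm i ≈ 0#
      eigenTerm≈0 = sum-nonneg-zero eigenTerm eigenTerm-nonneg
        (+-nonneg-zeroʳ (sum-nonneg vertexTerm vertexTerm-nonneg) (sum-nonneg eigenTerm eigenTerm-nonneg) balance)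

      x⊥vectors : ∀ i → x ∙ vectors i ≈ 0#
      x⊥vectors i with P? i
      ... | yes Pi = x⊥good Pi
      ... | no ¬Pi = square-zero (*-cancel-zero (τ≉0 i) (*-cancel-zero (proj₂ (negative i ¬Pi)) (eigenTerm≈0 i)))

-- Extremal closed walk counts and independent sets.

foldr₁-⊓-≤ : ∀ {n} (xs : Vec ℕ (suc n)) i → Vec.foldr₁ ℕ._⊓_ xs ℕ.≤ Vec.lookup xs i
foldr₁-⊓-≤ (x ∷ [])     zero    = ℕ.≤-refl
foldr₁-⊓-≤ (x ∷ y ∷ xs) zero    = ℕ.m⊓n≤m x _
foldr₁-⊓-≤ (x ∷ y ∷ xs) (suc i) = ℕ.≤-trans (ℕ.m⊓n≤n x _) (foldr₁-⊓-≤ (y ∷ xs) i)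

foldr₁-⊔-≥ : ∀ {n} (xs : Vec ℕ (suc n)) i → Vec.lookup xs i ℕ.≤ Vec.foldr₁ ℕ._⊔_ xs
foldr₁-⊔-≥ (x ∷ [])     zero    = ℕ.≤-refl
foldr₁-⊔-≥ (x ∷ y ∷ xs) zero    = ℕ.m≤m⊔n x _
foldr₁-⊔-≥ (x ∷ y ∷ xs) (suc i) = ℕ.≤-trans (foldr₁-⊔-≥ (y ∷ xs) i) (ℕ.m≤n⊔m x _)

w≤closedWalks : ∀ {n} .{{_ : NonZero n}} k (G : Graph n) u → w k G ℕ.≤ closedWalks k G u
w≤closedWalks {suc n} k G u = ≡.subst (w k G ℕ.≤_) (Vec.lookup∘tabulate (closedWalks k G) u)
  (foldr₁-⊓-≤ (Vec.tabulate (closedWalks k G)) u)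

closedWalks≤W : ∀ {n} .{{_ : NonZero n}} k (G : Graph n) u → closedWalks k G u ℕ.≤ W k G
closedWalks≤W {suc n} k G u = ≡.subst (ℕ._≤ W k G) (Vec.lookup∘tabulate (closedWalks k G) u)
  (foldr₁-⊔-≥ (Vec.tabulate (closedWalks k G)) u)

module _ {n} (k : ℕ) (G : Graph n) where

  α-≤ : ∀ {b} → (∀ U → Independent G k U → ∣ U ∣ ℕ.≤ b) → α k G ℕ.≤ b
  α-≤ bound = max≤v⁺ ℕ.z≤n (All.map
    (λ { (U , ≡.refl , independent) → bound U independent })
    (all-filter (independentSetOfSize? G k) (upTo (suc n))))

  -- A walk of length `k` need not be shortest, so all lengths up to `k` are excluded by strong
  -- induction: with no shorter walk, a walk of length `d` would make `d` the distance.
  farther⇒¬walk : ∀ {u v} → FartherThan G k u v → ¬ Walk G u v k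
  farther⇒¬walk {u} {v} farther = <-rec (λ d → d ℕ.≤ k → ¬ Walk G u v d)
    (λ d shorter d≤k walk → ℕ.<⇒≱
      (farther d (walk , λ ℓ<d → shorter ℓ<d (ℕ.≤-trans (ℕ.<⇒≤ ℓ<d) d≤k))) d≤k)
    k ℕ.≤-refl

-- Powers of the adjacency matrix over the naturals and over the field.

module WalkCounting {c ℓ₁ ℓ₂} (F : OrderedField c ℓ₁ ℓ₂) {n} (G : Graph n) where
  open OrderedField F hiding (zero)
  open Graph G
  open LinearAlgebra F using (sum-zero)
  open SemiringSum semiring using (sum; sum-cong-≋)
  open SemiringMatrix semiring using (_^ᴹ_)
  open Spectrum F using (fromℕ)
  open MonoidMultiplication +-monoid using (×-homo-+)
  open SemiringMultiplication semiring using (×1-homo-*)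
  open SetoidReasoning setoid
  module ℕMatrix = SemiringMatrix ℕ.+-*-semiring
  module ℕSum = SemiringSum ℕ.+-*-semiring

  A  = adjacencyMatrix semiring G
  Aℕ = adjacencyMatrix ℕ.+-*-semiring G

  A-symmetric : ∀ i j → A i j ≈ A j i
  A-symmetric i j with adj? i j | adj? j i
  ... | yes _ | yes _ = refl
  ... | no _  | no _  = refl
  ... | yes e | no ¬e = contradiction (symmetric e) ¬e
  ... | no ¬e | yes e = contradiction (symmetric e) ¬e

  fromℕ-indicator : ∀ b → fromℕ (if b then 1 else 0) ≈ (if b then 1# else 0#)
  fromℕ-indicator true  = +-identityʳ 1#
  fromℕ-indicator false = refl

  fromℕ-sum : ∀ {m} (t : Vector ℕ m) → fromℕ (ℕSum.sum t) ≈ sum (λ i → fromℕ (t i))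
  fromℕ-sum {zero}  t = refl
  fromℕ-sum {suc m} t = trans (×-homo-+ 1# (t zero) (ℕSum.sum (tail t))) (+-congˡ (fromℕ-sum (tail t)))

  fromℕ-power : ∀ k i j → fromℕ ((Aℕ ℕMatrix.^ᴹ k) i j) ≈ (A ^ᴹ k) i j
  fromℕ-power zero    i j = fromℕ-indicator (does (i Fin.≟ j))
  fromℕ-power (suc k) i j = trans (fromℕ-sum (λ l → Aℕ i l ℕ.* (Aℕ ℕMatrix.^ᴹ k) l j))
    (sum-cong-≋ λ l → trans (×1-homo-* (Aℕ i l) ((Aℕ ℕMatrix.^ᴹ k) l j))
      (*-cong (fromℕ-indicator (does (adj? i l))) (fromℕ-power k l j)))

  -- In each term of the matrix product either the edge is absent or the remaining power has no walk
  -- to count, since the two would join to a walk from `u` to `v`.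
  power-¬walk : ∀ k {u v} → ¬ Walk G u v k → (A ^ᴹ k) u v ≈ 0#
  power-¬walk zero {u} {v} ¬walk with u Fin.≟ v
  ... | yes ≡.refl = contradiction [] ¬walk
  ... | no _       = refl
  power-¬walk (suc k) {u} {v} ¬walk = sum-zero term
    where
    term : ∀ l → A u l * (A ^ᴹ k) l v ≈ 0#
    term l with adj? u l
    ... | yes e = trans (*-congˡ (power-¬walk k (¬walk ∘ (e ∷_)))) (zeroʳ _)
    ... | no _  = zeroˡ _

theorem3p2 : ∀ {c ℓ₁ ℓ₂} (F : OrderedField c ℓ₁ ℓ₂) →
    let open OrderedField F
        open Spectrum F in
    ∀ (k : ℕ) → k ℕ.≥ 1 →
    ∀ (n : ℕ) .{{_ : NonZero n}} (G : Graph n) (λs : Vector Carrier n) →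
    IsSpectrum (adjacencyMatrix semiring G) λs →
    α k G ℕ.≤ #[ (λ i → fromℕ (w k G) ≤? λs i ^ k) ]
    × α k G ℕ.≤ #[ (λ i → λs i ^ k ≤? fromℕ (W k G)) ]
theorem3p2 F k _ n G λs spectrum = α-≤ k G lower , α-≤ k G upper
  where
  open OrderedField F hiding (zero)
  open Spectrum F
  open SemiringMatrix semiring using (_^ᴹ_)
  open WalkCounting F G
  open Order F
  open Inertia F A A-symmetric λs spectrum using (inertia)
  open ℤSolver commutativeRing using (solve; _:=_; _:+_; _:*_; _:-_; :-_; con)

  offDiagonal : ∀ {U} → Independent G k U → ∀ {u v} → u ∈ U → v ∈ U → u ≢ v → (A ^ᴹ k) u v ≈ 0#
  offDiagonal independent u∈U v∈U u≢v =
    power-¬walk k (farther⇒¬walk k G (independent _ _ u∈U v∈U u≢v))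

  1*-difference : ∀ a b → a - b ≈ 1# * (a - b)
  1*-difference a b = sym (*-identityˡ _)

  -1*-difference : ∀ a b → a - b ≈ - 1# * (b - a)
  -1*-difference = solve 2 (λ a b → a :- b := :- con (ℤ.+ 1) :* (b :- a)) refl

  -- Strict positivity is expressed as nonnegative and nonzero. The parameter `d` lets the
  -- difference appear as a multiple by `1#` or `- 1#`, the form required by `inertia`.
  positive : ∀ {a b d} → a - b ≈ d → ¬ (a ≤ b) → 0# ≤ d × d ≉ 0#
  positive {a} {b} a-b≈d a≰b with total a b
  ... | inj₁ a≤b = contradiction a≤b a≰b
  ... | inj₂ b≤a = ≤-resp refl a-b≈d (0≤y-x b≤a) , λ d≈0 → a≰b (≤-reflexive
    (trans (solve 2 (λ a b → a := b :+ (a :- b)) refl a b) (trans (+-congˡ (trans a-b≈d d≈0)) (+-identityʳ b))))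

  nonneg : ∀ {a b d} → a - b ≈ d → b ≤ a → 0# ≤ d
  nonneg a-b≈d b≤a = ≤-resp refl a-b≈d (0≤y-x b≤a)

  lower : ∀ U → Independent G k U → ∣ U ∣ ℕ.≤ #[ (λ i → fromℕ (w k G) ≤? λs i ^ k) ]
  lower U independent = inertia (λ i → fromℕ (w k G) ≤? λs i ^ k) k 1# (fromℕ (w k G)) U
    (λ i → positive (1*-difference _ _))
    (λ u → nonneg (1*-difference _ _) (≤-resp refl (fromℕ-power k u u) (fromℕ-mono-≤ (w≤closedWalks k G u))))
    (offDiagonal independent)

  upper : ∀ U → Independent G k U → ∣ U ∣ ℕ.≤ #[ (λ i → λs i ^ k ≤? fromℕ (W k G)) ]
  upper U independent = inertia (λ i → λs i ^ k ≤? fromℕ (W k G)) k (- 1#) (fromℕ (W k G)) U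
    (λ i → positive (-1*-difference _ _))
    (λ u → nonneg (-1*-difference _ _) (≤-resp (fromℕ-power k u u) refl (fromℕ-mono-≤ (closedWalks≤W k G u))))
    (offDiagonal independent)
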